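{- For every $n\geq 1$, the map $(T,e)\mapsto \mathrm{Insertpoint}(T,e)$ is a bijection between the set of pairs $(T,e)$, where $T\in\mathcal{T}_n$ and $e$ is one of the $n+1$ boundary edges of $T$, and the set $\mathcal{T}_{n+1}$.
   Context: A Ferrers diagram is a finite set of unit cells of $\mathbb{Z}^2$ forming left-justified rows whose lengths weakly decrease from top to bottom, considered up to translation. Its boundary edges are the unit edges on its Southeast border path (from its bottom-left corner to its top-right corner); their number equals the half-perimeter (number of rows plus number of columns). A boundary cell is a cell with no other cell of the diagram to its Southeast. Boundary edges and boundary cells are ordered from Southwest to Northeast along the border path; the Southeast corners of boundary cells interleave with boundary edges. A tree-like tableau is a Ferrers diagram in which each cell is either empty or pointed, such that: (1) the top-left cell is pointed (the root point); (2) every non-root pointed cell has either a pointed cell above it in its column or a pointed cell to its left in its row, but not both; (3) every row and every column contains a pointed cell. A tree-like tableau of half-perimeter $n+1$ has exactly $n$ points; $n$ is its size, and $\mathcal{T}_n$ denotes the set of tree-like tableaux of size $n$. Inserting a column at a boundary edge $e$ which is the right end of a row $r$ means adding one cell at the right end of $r$ and of every row above $r$; inserting a row at a boundary edge $e$ which is the bottom end of a column $c$ means adding one cell at the bottom of $c$ and of every column to the left of $c$. The special point of $T$ is the Northeast-most (i.e. rightmost) among the pointed cells which are the lowest cell of their column (its cell is a boundary cell). $\mathrm{Insertpoint}(T,e)$ is defined as follows: let $T'$ be obtained by inserting a column (if $e$ is vertical) or a row (if $e$ is horizontal) at $e$, with all new cells empty except the lowest cell of the new column (resp. the rightmost cell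 of the new row), which is pointed. (1) If $e$ lies Northeast of the special point of $T$ along the border path (i.e. after the bottom edge of the special cell in the Southwest-to-Northeast order), then $\mathrm{Insertpoint}(T,e)=T'$. (2) Otherwise, add to $T'$ the ribbon of empty cells (a connected set of cells containing no $2\times 2$ square, whose union with $T'$ is a Ferrers diagram) starting at the cell immediately to the right of the new point and ending at the cell immediately below the special point of $T$; if $e$ is the bottom edge of the special cell, nothing is added. The result is $\mathrm{Insertpoint}(T,e)$, a tree-like tableau of size $n+1$. -}

module Defs where

open import Data.Nat using (ℕ; zero; suc; _+_; _∸_; _≤_; _<_; _<ᵇ_; _≤ᵇ_; _≡ᵇ_)
open import Data.Bool using (Bool; true; false; if_then_else_; _∧_)
open import Data.List using (List; []; _∷_; _++_; length; map; reverse; replicate; filter)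
open import Data.List.Relation.Unary.All using (All)
open import Data.List.Relation.Unary.Linked using (Linked)
open import Data.Maybe using (Maybe; just; nothing)
open import Data.Product using (_×_; _,_; ∃; proj₁; proj₂)
open import Data.Sum using (_⊎_)
open import Relation.Nullary using (¬_)
open import Relation.Binary.PropositionalEquality using (_≡_; _≢_)
open import Relation.Nullary.Decidable using (⌊_⌋)
import Data.Nat as ℕ

-- Raw tableaux.
-- A (pointed) Ferrers diagram is stored as the list of its rows, from top
-- to bottom; each row is the list of its cells from left to right; a cell
-- is `true` iff it is pointed.  Cell (i , j) = row i (0 = top), column j
-- (0 = leftmost).  Left-justification and "up to translation" are built in.

Raw : Set
Raw = List (List Bool)

nth : {A : Set} → List A → ℕ → Maybe A
nth []       _       = nothing
nth (x ∷ xs) zero    = just x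
nth (x ∷ xs) (suc k) = nth xs k

at : Raw → ℕ → ℕ → Maybe Bool
at T i j with nth T i
... | nothing = nothing
... | just r  = nth r j

Pointed : Raw → ℕ → ℕ → Set
Pointed T i j = at T i j ≡ just true

rowLen : Raw → ℕ → ℕ
rowLen T i with nth T i
... | nothing = 0
... | just r  = length r

ncols : Raw → ℕ
ncols T = rowLen T 0

colLen : Raw → ℕ → ℕ
colLen T j = length (filter (λ r → j ℕ.<? length r) T)

IsFerrers : Raw → Set
IsFerrers T = All (λ r → 1 ≤ length r) T × Linked (λ a b → b ≤ a) (map length T)

halfPerimeter : Raw → ℕ
halfPerimeter T = length T + ncols T

record IsTLT (n : ℕ) (T : Raw) : Set where
  field
    ferrers   : IsFerrers T
    size      : halfPerimeter T ≡ suc n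
    root      : Pointed T 0 0
    treeCond  : ∀ i j → Pointed T i j → ¬ (i ≡ 0 × j ≡ 0) →
                  ((∃ λ i' → i' < i × Pointed T i' j) ⊎ (∃ λ j' → j' < j × Pointed T i j'))
                × ¬ ((∃ λ i' → i' < i × Pointed T i' j) × (∃ λ j' → j' < j × Pointed T i j'))
    rowCond   : ∀ i → i < length T → ∃ λ j → Pointed T i j
    colCond   : ∀ j → j < ncols T → ∃ λ i → Pointed T i j

-- Boundary edges.
-- vert r : the vertical edge at the right end of row r
-- horiz c : the horizontal edge at the bottom end of column c

data Edge : Set where
  vert  : ℕ → Edge
  horiz : ℕ → Edge

hdesc : ℕ → ℕ → List Edge
hdesc b zero    = []
hdesc b (suc k) = horiz (b + k) ∷ hdesc b k

nextLen : List ℕ → ℕ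
nextLen []      = 0
nextLen (l ∷ _) = l

-- border path from the top-right corner to the bottom-left corner,
-- given the row index of the first row and the remaining row lengths
neEdges : ℕ → List ℕ → List Edge
neEdges i []       = []
neEdges i (l ∷ ls) = vert i ∷ (hdesc (nextLen ls) (l ∸ nextLen ls) ++ neEdges (suc i) ls)

-- the boundary edges ordered from Southwest to Northeast
edges : Raw → List Edge
edges T = reverse (neEdges 0 (map length T))

_==ᴱ_ : Edge → Edge → Bool
vert a  ==ᴱ vert b  = a ≡ᵇ b
horiz a ==ᴱ horiz b = a ≡ᵇ b
_       ==ᴱ _       = false

indexOf : Edge → List Edge → ℕ
indexOf e []       = 0
indexOf e (f ∷ fs) = if e ==ᴱ f then 0 else suc (indexOf e fs)

bottomPointed : Raw → ℕ → Bool
bottomPointed T j with at T (colLen T j ∸ 1) j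
... | just true = true
... | _         = false

specialFrom : Raw → ℕ → Maybe (ℕ × ℕ)
specialFrom T zero    = nothing
specialFrom T (suc j) =
  if bottomPointed T j then just (colLen T j ∸ 1 , j) else specialFrom T j

special : Raw → Maybe (ℕ × ℕ)
special T = specialFrom T (ncols T)

insertAt : {A : Set} → ℕ → A → List A → List A
insertAt zero    x ys       = x ∷ ys
insertAt (suc k) x []       = x ∷ []
insertAt (suc k) x (y ∷ ys) = y ∷ insertAt k x ys

colInsertFrom : ℕ → ℕ → ℕ → Raw → Raw
colInsertFrom r c i []       = []
colInsertFrom r c i (x ∷ xs) =
  (if i <ᵇ r then insertAt c false x
   else if i ≡ᵇ r then insertAt c true x
   else x) ∷ colInsertFrom r c (suc i) xs

newRow : ℕ → List Bool
newRow c = replicate c false ++ (true ∷ [])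

insertLine : Raw → Edge → Raw
insertLine T (vert r)  = colInsertFrom r (rowLen T r) 0 T
insertLine T (horiz c) = insertAt (colLen T c) (newRow c) T

newPoint : Raw → Edge → ℕ × ℕ
newPoint T (vert r)  = r , rowLen T r
newPoint T (horiz c) = colLen T c , c

shiftCell : Raw → Edge → ℕ × ℕ → ℕ × ℕ
shiftCell T (vert r)  (p , q) =
  if (p ≤ᵇ r) ∧ (rowLen T r ≤ᵇ q) then (p , suc q) else (p , q)
shiftCell T (horiz c) (p , q) =
  if colLen T c ≤ᵇ p then (suc p , q) else (p , q)

-- Ribbon.  Given a tableau U (row lengths μ), the cell (p , q) (the
-- special point) and the row a of the new point (which is the last cell
-- of row a), add the ribbon of empty cells going along the outer rim of U
-- from the cell right of the new point to the cell (p + 1 , q):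
-- row p + 1 is extended to length q + 1, and each row i with
-- p + 1 < i ≤ a is extended to length μ_{i-1} + 1.

extendTo : ℕ → List Bool → List Bool
extendTo m x = x ++ replicate (m ∸ length x) false

ribbonFrom : Raw → ℕ → ℕ → ℕ → ℕ → Raw → Raw
ribbonFrom U p q a i []       = []
ribbonFrom U p q a i (x ∷ xs) =
  (if (i ≡ᵇ suc p) ∧ (i ≤ᵇ a) then extendTo (suc q) x
   else if (suc p <ᵇ i) ∧ (i ≤ᵇ a) then extendTo (suc (rowLen U (i ∸ 1))) x
   else x) ∷ ribbonFrom U p q a (suc i) xs

addRibbon : Raw → ℕ × ℕ → ℕ → Raw
addRibbon U (p , q) a = ribbonFrom U p q a 0 U

insertPoint : Raw → Edge → Raw
insertPoint T e with special T
... | nothing       = insertLine T e   -- never happens for tree-like tableaux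
... | just (p , q)  =
  if indexOf (horiz q) (edges T) <ᵇ indexOf e (edges T)
  then insertLine T e
  else addRibbon (insertLine T e) (shiftCell T e (p , q)) (proj₁ (newPoint T e))

{-# OPTIONS --safe #-}

-- The new point of Insertpoint(T , e) is its special point, so it can be read off
-- the result. Insertion therefore splits into two invertible steps.
--
-- Inserting the line alone turns (T , e) into a tableau T′ with a marked pointed
-- corner. Such a corner has a point above it or a point to its left, not both: in
-- the first case it is the only point of its row, in the second the only point of
-- its column, and deleting that line recovers (T , e).
--
-- Adding the ribbon changes the shape but not the points. If the special point of
-- the result is not at the end of its row, a ribbon was added, and it is recovered
-- by following the rim upwards from the special point until the end of a row lies
-- under a pointed cell. Such a row exists because the last column contains a point.
module Submission where

open import Defs
open import Data.Nat
open import Data.Nat.Properties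
open import Data.Bool using (Bool; true; false; if_then_else_; _∧_)
import Data.Bool.Properties as Boolₚ
open import Data.Empty using (⊥-elim)
open import Data.List using (List; []; _∷_; _++_; length; map; replicate; reverse; take)
open import Data.List.Properties
  using (++-identityʳ; filter-accept; filter-reject; length-++; length-filter; length-map;
      length-replicate; length-take; unfold-reverse)
open import Data.List.Membership.Propositional using (_∈_)
open import Data.List.Membership.Propositional.Properties using (∈-++⁺ˡ; ∈-++⁺ʳ; ∈-++⁻)
open import Data.List.Relation.Unary.All as All using (All; []; _∷_)
import Data.List.Relation.Unary.All.Properties as Allₚ
open import Data.List.Relation.Unary.AllPairs using (AllPairs; []; _∷_)
import Data.List.Relation.Unary.AllPairs.Properties as AllPairsₚ
open import Data.List.Relation.Unary.Any using (here; there)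
import Data.List.Relation.Unary.Any.Properties as Anyₚ
open import Data.List.Relation.Unary.Linked using (Linked; []; [-]; _∷_)
open import Data.Maybe as Maybe using (Maybe; just; nothing)
import Data.Maybe.Properties as Maybeₚ
open import Data.Product using (_×_; _,_; ∃; ∃₂; proj₁; proj₂)
open import Data.Sum as Sum using (_⊎_; inj₁; inj₂)
open import Data.Unit using (tt)
open import Function using (flip; _∘_)
open import Relation.Binary.Definitions using (tri<; tri≈; tri>)
open import Relation.Binary.PropositionalEquality
open import Relation.Nullary using (¬_; Dec; yes; no; contradiction)
open import Relation.Nullary.Decidable using (dec-true; dec-false)

-- Why the new point becomes special: a line inserted before the special point leaves that point
-- lowest in its column, at some `(p , q)` to the right of the new point `(a , b)`. The ribbon gives
-- each of the columns `suc b` to `q` at least one new cell at the bottom, so no point there is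
-- lowest any more; points beyond `q` were not lowest before.
--
-- Why the removed ribbon is forced: a ribbon has to end under a pointed cell, and one that
-- continued past the first such place met on the way up would contain that pointed cell.
--
-- The obstacle is that `insertPoint` entangles the edge with its position in a list and with
-- coordinates that shift under the insertion. The ribbon step is therefore restated as a relation
-- `Ribboned` that does not mention the edge: whether a ribbon is added depends only on whether the
-- marked corner is already special. Line insertion is likewise a relation between grids. Both
-- relations are functional and injective, so the inverse map never has to be computed through the
-- list operations.

private variable
  X : Set

-- Renumbering around an inserted index

-- skip c enumerates ℕ ∖ {c} increasingly.
skip : ℕ → ℕ → ℕ
skip zero    j       = suc j
skip (suc c) zero    = zero
skip (suc c) (suc j) = suc (skip c j)

data SkipView (c : ℕ) : ℕ → Set where
  hole : SkipView c c
  kept : ∀ j → SkipView c (skip c j)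

skipView : ∀ c j → SkipView c j
skipView zero    zero    = hole
skipView zero    (suc j) = kept j
skipView (suc c) zero    = kept zero
skipView (suc c) (suc j) with skipView c j
... | hole   = hole
... | kept k = kept (suc k)

skip-< : ∀ {c j} → j < c → skip c j ≡ j
skip-< {suc c} {zero}  _       = refl
skip-< {suc c} {suc j} (s≤s p) = cong suc (skip-< p)

skip-≥ : ∀ {c j} → c ≤ j → skip c j ≡ suc j
skip-≥ {zero}          _       = refl
skip-≥ {suc c} {suc j} (s≤s p) = cong suc (skip-≥ p)

skip≤suc : ∀ c j → skip c j ≤ suc j
skip≤suc zero    j       = ≤-refl
skip≤suc (suc c) zero    = z≤n
skip≤suc (suc c) (suc j) = s≤s (skip≤suc c j)

skip-mono-≤ : ∀ c {j k} → j ≤ k → skip c j ≤ skip c k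
skip-mono-≤ zero            p       = s≤s p
skip-mono-≤ (suc c) {zero}  p       = z≤n
skip-mono-≤ (suc c) {suc j} (s≤s p) = s≤s (skip-mono-≤ c p)

skip-mono-< : ∀ c {j k} → j < k → skip c j < skip c k
skip-mono-< zero            p               = s≤s p
skip-mono-< (suc c) {zero}  {suc k} p       = s≤s z≤n
skip-mono-< (suc c) {suc j} {suc k} (s≤s p) = s≤s (skip-mono-< c p)

skip-cancel-≤ : ∀ c {j k} → skip c j ≤ skip c k → j ≤ k
skip-cancel-≤ c {j} {k} p = ≮⇒≥ λ k<j → <⇒≱ (skip-mono-< c k<j) p

skip-cancel-< : ∀ c {j k} → skip c j < skip c k → j < k
skip-cancel-< c {j} {k} p = ≰⇒> λ k≤j → <⇒≱ p (skip-mono-≤ c k≤j)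

skip≤⇒< : ∀ c {j} → skip c j ≤ c → j < c
skip≤⇒< c {j} p = ≰⇒> λ c≤j → <⇒≱ (subst (c <_) (sym (skip-≥ c≤j)) (s≤s c≤j)) p

≤skip⇒≤ : ∀ c {j} → c ≤ skip c j → c ≤ j
≤skip⇒≤ c {j} p = ≮⇒≥ λ j<c → <⇒≱ (subst (_< c) (sym (skip-< j<c)) j<c) p

skip<suc⇒ : ∀ c {j w} → c ≤ w → skip c j < suc w → j < w
skip<suc⇒ c {j} {w} c≤w p with j <? c
... | yes j<c = <-≤-trans j<c c≤w
... | no  j≮c = s≤s⁻¹ (subst (_< suc w) (skip-≥ (≮⇒≥ j≮c)) p)

-- Tree-like tableaux as grids

-- Tableaux are compared through the functions at T: transposition is then flip, and
-- statements about an inserted row are those about an inserted column of the flipped grid.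
Grid : Set
Grid = ℕ → ℕ → Maybe Bool

Cell Point : Grid → ℕ → ℕ → Set
Cell  A i j = ∃ λ b → A i j ≡ just b
Point A i j = A i j ≡ just true

PointAbove PointLeft : Grid → ℕ → ℕ → Set
PointAbove A i j = ∃ λ i′ → i′ < i × Point A i′ j
PointLeft  A i j = ∃ λ j′ → j′ < j × Point A i j′

point⇒cell : ∀ (A : Grid) {i j} → Point A i j → Cell A i j
point⇒cell A p = true , p

no-cell : ∀ (A : Grid) {i j} → A i j ≡ nothing → ¬ Cell A i j
no-cell A e (b , e′) with () ← trans (sym e) e′

no-point : ∀ (A : Grid) {i j} → A i j ≡ just false → ¬ Point A i j
no-point A e e′ with () ← trans (sym e) e′

-- Height and width are fields, tied to column 0 and row 0 by implications, so that transposition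
-- just swaps them; `IsTLT` obtains the two numbers in different ways and is not visibly symmetric.
record TLT (n : ℕ) (A : Grid) : Set where
  field
    height width : ℕ
    height⇒ : ∀ {i} → i < height → Cell A i 0
    height⇐ : ∀ {i} → Cell A i 0 → i < height
    width⇒  : ∀ {j} → j < width → Cell A 0 j
    width⇐  : ∀ {j} → Cell A 0 j → j < width
    size    : height + width ≡ suc n
    down    : ∀ {i j i′ j′} → i′ ≤ i → j′ ≤ j → Cell A i j → Cell A i′ j′
    root    : Point A 0 0
    parent  : ∀ {i j} → Point A i j → ¬ (i ≡ 0 × j ≡ 0) → PointAbove A i j ⊎ PointLeft A i j
    single  : ∀ {i j} → Point A i j → ¬ (i ≡ 0 × j ≡ 0) → PointAbove A i j → ¬ PointLeft A i j
    rows    : ∀ {i} → Cell A i 0 → ∃ λ j → Point A i j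
    columns : ∀ {j} → Cell A 0 j → ∃ λ i → Point A i j

flip-TLT : ∀ {n A} → TLT n A → TLT n (flip A)
flip-TLT t = record
  { height = width ; width = height
  ; height⇒ = width⇒ ; height⇐ = width⇐ ; width⇒ = height⇒ ; width⇐ = height⇐
  ; size = trans (+-comm width height) size
  ; down = λ p q → down q p
  ; root = root
  ; parent = λ p ≢0 → Sum.swap (parent p λ (i , j) → ≢0 (j , i))
  ; single = λ p ≢0 u l → single p (λ (i , j) → ≢0 (j , i)) l u
  ; rows = columns ; columns = rows }
  where open TLT t

-- Inserting and deleting a line in a grid

-- `keep` recovers `A` from `A′`; the other fields fix the new column. `within` and `full` say that
-- row `r` of `A` has exactly `c` cells, so the column goes in at its right end.
record ColumnInserted (r c : ℕ) (A A′ : Grid) : Set where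
  field
    keep   : ∀ i j → A′ i (skip c j) ≡ A i j
    above  : ∀ {i} → i < r → A′ i c ≡ just false
    new    : A′ r c ≡ just true
    below  : ∀ {i} → r < i → A′ i c ≡ nothing
    pos    : 0 < c
    within : ∀ {j} → Cell A r j → j < c
    full   : ∀ {j} → j < c → Cell A r j

module _ {r c : ℕ} {A A′ : Grid} (ins : ColumnInserted r c A A′) where
  open ColumnInserted ins

  keepᶜ : ∀ {i j} → Cell A i j → Cell A′ i (skip c j)
  keepᶜ {i} {j} (b , e) = b , trans (keep i j) e

  keepᶜ⁻ : ∀ {i j} → Cell A′ i (skip c j) → Cell A i j
  keepᶜ⁻ {i} {j} (b , e) = b , trans (sym (keep i j)) e

  keepᵖ : ∀ {i j} → Point A i j → Point A′ i (skip c j)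
  keepᵖ {i} {j} e = trans (keep i j) e

  keepᵖ⁻ : ∀ {i j} → Point A′ i (skip c j) → Point A i j
  keepᵖ⁻ {i} {j} e = trans (sym (keep i j)) e

  skip0 : skip c 0 ≡ 0
  skip0 = skip-< pos

  new-cell : ∀ {i} → i ≤ r → Cell A′ i c
  new-cell i≤r with m≤n⇒m<n∨m≡n i≤r
  ... | inj₁ i<r  = false , above i<r
  ... | inj₂ refl = true , new

  new-cell⁻ : ∀ {i} → Cell A′ i c → i ≤ r
  new-cell⁻ x = ≮⇒≥ λ r<i → no-cell A′ (below r<i) x

  new-point⁻ : ∀ {i} → Point A′ i c → i ≡ r
  new-point⁻ {i} x with m≤n⇒m<n∨m≡n (new-cell⁻ (point⇒cell A′ x))
  ... | inj₁ i<r  = contradiction x (no-point A′ (above i<r))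
  ... | inj₂ refl = refl

  no-above : ¬ PointAbove A′ r c
  no-above (i , i<r , x) = no-point A′ (above i<r) x

  corner-right : ¬ Cell A′ r (suc c)
  corner-right x = <-irrefl refl
    (within (keepᶜ⁻ (subst (Cell A′ r) (sym (skip-≥ {c} ≤-refl)) x)))

  column0 : ∀ {i} → Cell A i 0 → Cell A′ i 0
  column0 {i} x = subst (Cell A′ i) skip0 (keepᶜ x)

  column0⁻ : ∀ {i} → Cell A′ i 0 → Cell A i 0
  column0⁻ {i} x = keepᶜ⁻ (subst (Cell A′ i) (sym skip0) x)

  point-left : ∀ {n} → TLT n A → PointLeft A′ r c
  point-left t with TLT.rows t (full pos)
  ... | j , x = j , j<c , subst (Point A′ r) (skip-< j<c) (keepᵖ x)
    where j<c = within (point⇒cell A x)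

  -- Row `r` already has a point, which lies left of the new one, and the cells above the new point
  -- are empty. The new point ends its row and is alone in its column, so it is neither above nor to
  -- the left of an old point.
  insert-TLT : ∀ {n} → TLT n A → TLT (suc n) A′
  insert-TLT {n} t = record
    { height = T.height ; width = suc T.width
    ; height⇒ = column0 ∘ T.height⇒ ; height⇐ = T.height⇐ ∘ column0⁻
    ; width⇒ = width⇒ ; width⇐ = width⇐
    ; size = trans (+-suc T.height T.width) (cong suc T.size)
    ; down = down
    ; root = subst (Point A′ 0) skip0 (keepᵖ T.root)
    ; parent = parent ; single = single
    ; rows = λ x → let j , y = T.rows (column0⁻ x) in skip c j , keepᵖ y
    ; columns = columns }
    where
    module T = TLT t
    c≤w : c ≤ T.width
    c≤w = ≮⇒≥ λ w<c → <-irrefl refl (T.width⇐ (T.down z≤n ≤-refl (full w<c)))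
    width⇒ : ∀ {j} → j < suc T.width → Cell A′ 0 j
    width⇒ {j} p with skipView c j
    ... | hole   = new-cell z≤n
    ... | kept k = keepᶜ (T.width⇒ (skip<suc⇒ c c≤w p))
    width⇐ : ∀ {j} → Cell A′ 0 j → j < suc T.width
    width⇐ {j} x with skipView c j
    ... | hole   = s≤s c≤w
    ... | kept k = s≤s (≤-trans (skip≤suc c k) (T.width⇐ (keepᶜ⁻ x)))
    down : ∀ {i j i′ j′} → i′ ≤ i → j′ ≤ j → Cell A′ i j → Cell A′ i′ j′
    down {i} {j} {i′} {j′} p q x with skipView c j | skipView c j′
    ... | hole   | hole    = new-cell (≤-trans p (new-cell⁻ x))
    ... | hole   | kept k  = keepᶜ (T.down (≤-trans p (new-cell⁻ x)) ≤-refl (full (skip≤⇒< c q)))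
    ... | kept m | hole    = new-cell (≮⇒≥ λ r<i′ → <-irrefl refl
                               (within (T.down (<⇒≤ (<-≤-trans r<i′ p)) (≤skip⇒≤ c q) (keepᶜ⁻ x))))
    ... | kept m | kept k  = keepᶜ (T.down p (skip-cancel-≤ c q) (keepᶜ⁻ x))
    ≢root : ∀ {i k} → ¬ (i ≡ 0 × skip c k ≡ 0) → ¬ (i ≡ 0 × k ≡ 0)
    ≢root ≢0 (refl , refl) = ≢0 (refl , skip0)
    parent : ∀ {i j} → Point A′ i j → ¬ (i ≡ 0 × j ≡ 0) → PointAbove A′ i j ⊎ PointLeft A′ i j
    parent {i} {j} x ≢0 with skipView c j
    ... | hole with refl ← new-point⁻ x = inj₂ (point-left t)
    ... | kept k = Sum.map (λ (i′ , p , y) → i′ , p , keepᵖ y)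
                           (λ (k′ , p , y) → skip c k′ , skip-mono-< c p , keepᵖ y)
                           (T.parent (keepᵖ⁻ x) (≢root ≢0))
    single : ∀ {i j} → Point A′ i j → ¬ (i ≡ 0 × j ≡ 0) → PointAbove A′ i j → ¬ PointLeft A′ i j
    single {i} {j} x ≢0 (i′ , p , y) (j′ , q , z) with skipView c j
    ... | hole with refl ← new-point⁻ x = no-above (i′ , p , y)
    ... | kept k with skipView c j′
    ... | kept k′ = T.single (keepᵖ⁻ x) (≢root ≢0) (i′ , p , keepᵖ⁻ y)
        (k′ , skip-cancel-< c q , keepᵖ⁻ z)
    ... | hole with refl ← new-point⁻ z =
      <⇒≱ (within (point⇒cell A (keepᵖ⁻ x))) (≤skip⇒≤ c (<⇒≤ q))
    columns : ∀ {j} → Cell A′ 0 j → ∃ λ i → Point A′ i j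
    columns {j} x with skipView c j
    ... | hole   = r , new
    ... | kept k = let i , y = T.columns (keepᶜ⁻ x) in i , keepᵖ y

  -- The point to the left remains in row `r`, so this row still has a point. No point loses its
  -- parent, because the deleted one ends its row and is alone in its column.
  delete-TLT : ∀ {n} → PointLeft A′ r c → TLT (suc n) A′ → TLT n A
  delete-TLT {n} (j₀ , j₀<c , p₀) t = go T.width refl
    where
    module T = TLT t
    c<w : c < T.width
    c<w = T.width⇐ (new-cell z≤n)
    -- The new width is the predecessor of the old one, which is positive because it exceeds `c`.
    go : ∀ w → w ≡ T.width → TLT n A
    go zero    eq = contradiction (subst (c <_) (sym eq) c<w) λ ()
    go (suc w) eq = record
      { height = T.height ; width = w
      ; height⇒ = column0⁻ ∘ T.height⇒ ; height⇐ = T.height⇐ ∘ column0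
      ; width⇒ = λ {j} p → keepᶜ⁻ (T.width⇒ (subst (skip c j <_) eq (s≤s (≤-trans (skip≤suc c j) p))))
      ; width⇐ = λ {j} x → skip<suc⇒ c (s≤s⁻¹ (subst (c <_) (sym eq) c<w))
                              (subst (skip c j <_) (sym eq) (T.width⇐ (keepᶜ x)))
      ; size = suc-injective (trans (sym (+-suc T.height w)) (trans (cong (T.height +_) eq) T.size))
      ; down = λ p q x → keepᶜ⁻ (T.down p (skip-mono-≤ c q) (keepᶜ x))
      ; root = keepᵖ⁻ (subst (Point A′ 0) (sym skip0) T.root)
      ; parent = λ x ≢0 → parent x (T.parent (keepᵖ x) (≢root ≢0))
      ; single = λ x ≢0 (i′ , p , y) (j′ , q , z) →
          T.single (keepᵖ x) (≢root ≢0) (i′ , p , keepᵖ y) (skip c j′ , skip-mono-< c q , keepᵖ z)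
      ; rows = λ x → rows (T.rows (column0 x))
      ; columns = λ x → let i , y = T.columns (keepᶜ x) in i , keepᵖ⁻ y }
      where
      ≢root : ∀ {i k} → ¬ (i ≡ 0 × k ≡ 0) → ¬ (i ≡ 0 × skip c k ≡ 0)
      ≢root {k = zero}  ≢0 (refl , _) = ≢0 (refl , refl)
      ≢root {k = suc k} ≢0 (_ , e) with () ← subst (0 <_) e (≤-<-trans z≤n (skip-mono-< c (s≤s z≤n)))
      parent : ∀ {i j} → Point A i j → PointAbove A′ i (skip c j) ⊎ PointLeft A′ i (skip c j) →
               PointAbove A i j ⊎ PointLeft A i j
      parent x (inj₁ (i′ , p , y)) = inj₁ (i′ , p , keepᵖ⁻ y)
      parent x (inj₂ (j′ , p , y)) with skipView c j′
      ... | kept k = inj₂ (k , skip-cancel-< c p , keepᵖ⁻ y)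
      ... | hole with refl ← new-point⁻ y =
        contradiction (≤skip⇒≤ c (<⇒≤ p)) (<⇒≱ (within (point⇒cell A x)))
      rows : ∀ {i} → (∃ λ j → Point A′ i j) → ∃ λ j → Point A i j
      rows (j , x) with skipView c j
      ... | kept k = k , keepᵖ⁻ x
      ... | hole with refl ← new-point⁻ x = j₀ , keepᵖ⁻ (subst (Point A′ r) (sym (skip-< j₀<c)) p₀)

-- Pointed corners

Corner : Grid → ℕ → ℕ → Set
Corner A r c = Point A r c × ¬ Cell A (suc r) c × ¬ Cell A r (suc c)

flip-Corner : ∀ A {r c} → Corner A r c → Corner (flip A) c r
flip-Corner A (p , b , d) = p , d , b

insert-Corner : ∀ {r c A A′} → ColumnInserted r c A A′ → Corner A′ r c
insert-Corner {A′ = A′} ins = new , (no-cell A′ (below ≤-refl)) , corner-right ins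
  where open ColumnInserted ins

no-cell⁻ : ∀ (A : Grid) {i j} → ¬ Cell A i j → A i j ≡ nothing
no-cell⁻ A {i} {j} ¬x with A i j
... | nothing = refl
... | just b  = contradiction (b , refl) ¬x

cell-no-point : ∀ (A : Grid) {i j} → Cell A i j → ¬ Point A i j → A i j ≡ just false
cell-no-point A (false , e) _  = e
cell-no-point A (true  , e) ¬x = contradiction e ¬x

-- A point to the left forbids, by `single`, any point above. So the column of the corner is empty
-- above its point, and the missing cells below and beside the corner end the column and the row
-- there.
column-deleted : ∀ {n r c A A′} → TLT n A′ → Corner A′ r c → PointLeft A′ r c →
                 (∀ i j → A′ i (skip c j) ≡ A i j) → ColumnInserted r c A A′
column-deleted {r = r} {c} {A} {A′} t (x , ¬d , ¬r) left@(j₀ , j₀<c , _) keep = record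
  { keep = keep
  ; above = λ i<r → cell-no-point A′ (T.down (<⇒≤ i<r) ≤-refl (point⇒cell A′ x))
              λ y → T.single x (λ (_ , e) → <⇒≢ 0<c (sym e)) (_ , i<r , y) left
  ; new = x
  ; below = λ r<i → no-cell⁻ A′ λ y → ¬d (T.down r<i ≤-refl y)
  ; pos = 0<c
  ; within = λ {j} (b , y) → ≰⇒> λ c≤j →
      ¬r (T.down ≤-refl (s≤s c≤j) (b , trans (cong (A′ r) (sym (skip-≥ c≤j))) (trans (keep r j) y)))
  ; full = λ {j} j<c → let b , y = T.down ≤-refl (<⇒≤ j<c) (point⇒cell A′ x) in
      b , trans (sym (keep r j)) (trans (cong (A′ r) (skip-< j<c)) y) }
  where
  module T = TLT t
  0<c = ≤-<-trans z≤n j₀<c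

column-unique : ∀ {r c A B A′} → ColumnInserted r c A A′ → ColumnInserted r c B A′ → ∀ i j →
    A i j ≡ B i j
column-unique a b i j = trans (sym (ColumnInserted.keep a i j)) (ColumnInserted.keep b i j)

-- The special point under line insertion

-- `rightmost` expresses that no point strictly to the right is lowest in its column. Phrased by
-- cells instead of column lengths, it can be carried through an insertion cell by cell.
record Special (A : Grid) (p q : ℕ) : Set where
  constructor mkSpecial
  field
    point     : Point A p q
    bottom    : ¬ Cell A (suc p) q
    rightmost : ∀ {i j} → Point A i j → q < j → Cell A (suc i) j

Down : Grid → Set
Down A = ∀ {i j i′ j′} → i′ ≤ i → j′ ≤ j → Cell A i j → Cell A i′ j′

special-unique : ∀ {A p q p′ q′} → Down A → Special A p q → Special A p′ q′ → p ≡ p′ × q ≡ q′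
special-unique {A} {p} {q} {p′} {q′} down (mkSpecial x b m) (mkSpecial x′ b′ m′) with <-cmp q q′
... | tri< q<q′ _ _ = contradiction (m x′ q<q′) b′
... | tri> _ _ q′<q = contradiction (m′ x q′<q) b
... | tri≈ _ refl _ with <-cmp p p′
... | tri< p<p′ _ _ = contradiction (down p<p′ ≤-refl (point⇒cell A x′)) b
... | tri> _ _ p′<p = contradiction (down p′<p ≤-refl (point⇒cell A x)) b′
... | tri≈ _ refl _ = refl , refl

module _ {r c A A′ p q} (ins : ColumnInserted r c A A′) (s : Special A p q) where
  open ColumnInserted ins
  open Special s

  -- `Cell A r q` means `q < c`: the vertical edge comes after the special point. Points to the
  -- right of the new column come from points to the right of `q`, which have a cell below.
  column-special-new : Cell A r q → Special A′ r c
  column-special-new x = mkSpecial new (no-cell A′ (below ≤-refl)) right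
    where
    right : ∀ {i j} → Point A′ i j → c < j → Cell A′ (suc i) j
    right {i} {j} y c<j with skipView c j
    ... | hole   = contradiction c<j (<-irrefl refl)
    ... | kept k = keepᶜ ins (rightmost (keepᵖ⁻ ins y) (<-≤-trans (within x) (≤skip⇒≤ c (<⇒≤ c<j))))

  -- Here `c ≤ q`: the new column goes in left of the special point, moves it one step and puts no
  -- point to its right.
  column-special-old : ¬ Cell A r q → Special A′ p (skip c q)
  column-special-old ¬x = mkSpecial (keepᵖ ins point) (bottom ∘ keepᶜ⁻ ins) right
    where
    right : ∀ {i j} → Point A′ i j → skip c q < j → Cell A′ (suc i) j
    right {i} {j} y <j with skipView c j
    ... | hole   = contradiction (full (skip≤⇒< c (<⇒≤ <j))) ¬x
    ... | kept k = keepᶜ ins (rightmost (keepᵖ⁻ ins y) (skip-cancel-< c <j))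

module _ {r c A A′ p q} (ins : ColumnInserted c r (flip A) (flip A′)) (down : Down A)
    (s : Special A p q) where
  open ColumnInserted ins
  open Special s

  private
    -- Column `c` of `A` has `r` cells, so a column further right has no cell in row `r` or below.
    -- Hence the inserted row does not come between an old point there and the cell under it.
    row-right : ∀ {i j} → q < j → c < j → Point A′ i j → Cell A′ (suc i) j
    row-right {i} {j} q<j c<j y with skipView r i
    ... | hole   = contradiction c<j (<-irrefl (sym (new-point⁻ ins y)))
    ... | kept k with rightmost (keepᵖ⁻ ins y) q<j
    ... | x with suc k <? r
    ... | yes sk<r = subst (λ i → Cell A′ i j) (trans (skip-< sk<r)
        (cong suc (sym (skip-< (<-trans (n<1+n k) sk<r)))))
                       (keepᶜ ins x)
    ... | no  sk≮r = contradiction (within (down (≮⇒≥ sk≮r) (<⇒≤ c<j) x)) λ r<r → <-irrefl refl r<r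

  -- Equality is the case of the bottom edge of the special cell: the new point lands directly below
  -- the old special point and takes over its column.
  row-special-new : q ≤ c → Special A′ r c
  row-special-new q≤c = mkSpecial new (corner-right ins)
    λ y c<j → row-right (≤-<-trans q≤c c<j) c<j y

  row-special-old : c < q → p < r → Special A′ p q
  row-special-old c<q p<r = mkSpecial (subst (λ i → Point A′ i q) (skip-< p<r) (keepᵖ ins point))
    ¬b λ y q<j → row-right q<j (<-trans c<q q<j) y
    where
    ¬b : ¬ Cell A′ (suc p) q
    ¬b x with m≤n⇒m<n∨m≡n p<r
    ... | inj₁ sp<r = bottom (keepᶜ⁻ ins (subst (λ i → Cell A′ i q) (sym (skip-< sp<r)) x))
    -- The new row lies directly below the special point, but it stops at column `c`, left of `q`.
    ... | inj₂ refl = <⇒≱ c<q (new-cell⁻ ins x)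

-- Lists of rows read as grids

nth-just : ∀ (xs : List X) {k x} → nth xs k ≡ just x → k < length xs
nth-just (x ∷ xs) {zero}  _ = s≤s z≤n
nth-just (x ∷ xs) {suc k} e = s≤s (nth-just xs e)

nth-< : ∀ (xs : List X) {k} → k < length xs → ∃ λ x → nth xs k ≡ just x
nth-< (x ∷ xs) {zero}  _       = x , refl
nth-< (x ∷ xs) {suc k} (s≤s p) = nth-< xs p

nth-≥ : ∀ (xs : List X) {k} → length xs ≤ k → nth xs k ≡ nothing
nth-≥ []               _       = refl
nth-≥ (x ∷ xs) {suc k} (s≤s p) = nth-≥ xs p

nth-ext : ∀ (xs ys : List X) → (∀ k → nth xs k ≡ nth ys k) → xs ≡ ys
nth-ext []       []       e = refl
nth-ext []       (y ∷ ys) e with () ← e 0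
nth-ext (x ∷ xs) []       e with () ← e 0
nth-ext (x ∷ xs) (y ∷ ys) e = cong₂ _∷_ (Maybeₚ.just-injective (e 0)) (nth-ext xs ys (e ∘ suc))

NonEmptyRows : Raw → Set
NonEmptyRows = All (λ r → 1 ≤ length r)

at-just : ∀ (T : Raw) {i x} → nth T i ≡ just x → ∀ j → at T i j ≡ nth x j
at-just T e j rewrite e = refl

at-nothing : ∀ (T : Raw) {i} → nth T i ≡ nothing → ∀ j → at T i j ≡ nothing
at-nothing T e j rewrite e = refl

rowLen-just : ∀ (T : Raw) {i x} → nth T i ≡ just x → rowLen T i ≡ length x
rowLen-just T e rewrite e = refl

at-cong : ∀ (T U : Raw) {i i′} → nth T i ≡ nth U i′ → ∀ j → at T i j ≡ at U i′ j
at-cong T U {i} {i′} e j with nth T i | nth U i′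
... | nothing | nothing = refl
... | just x  | just y  = cong (λ z → nth z j) (Maybeₚ.just-injective e)

rowLen-cong : ∀ (T U : Raw) {i i′} → nth T i ≡ nth U i′ → rowLen T i ≡ rowLen U i′
rowLen-cong T U {i} {i′} e with nth T i | nth U i′
... | nothing | nothing = refl
... | just x  | just y  = cong length (Maybeₚ.just-injective e)

at-suc : ∀ x (T : Raw) i j → at (x ∷ T) (suc i) j ≡ at T i j
at-suc x T i = at-cong (x ∷ T) T {suc i} {i} refl

rowLen-suc : ∀ x (T : Raw) i → rowLen (x ∷ T) (suc i) ≡ rowLen T i
rowLen-suc x T i = rowLen-cong (x ∷ T) T {suc i} {i} refl

cell⇒< : ∀ (T : Raw) {i j} → Cell (at T) i j → j < rowLen T i
cell⇒< T {i} (b , e) with nth T i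
... | just r = nth-just r e

<⇒cell : ∀ (T : Raw) {i j} → j < rowLen T i → Cell (at T) i j
<⇒cell T {i} p with nth T i
... | just r = nth-< r p

rowLen-pos⇒ : ∀ (T : Raw) {i} → 0 < rowLen T i → i < length T
rowLen-pos⇒ T {i} p with nth T i in e
... | just r = nth-just T e

rowLen-pos⇐ : ∀ {T : Raw} {i} → NonEmptyRows T → i < length T → 0 < rowLen T i
rowLen-pos⇐ {x ∷ T} {zero}  (p ∷ _)  _       = p
rowLen-pos⇐ {x ∷ T} {suc i} (_ ∷ ps) (s≤s q) = subst (0 <_) (sym (rowLen-suc x T i)) (rowLen-pos⇐ ps q)

<-ext : ∀ {m n} → (∀ {k} → k < m → k < n) → (∀ {k} → k < n → k < m) → m ≡ n
<-ext {m} {n} f g = ≤-antisym (≮⇒≥ λ n<m → <-irrefl refl (f n<m)) (≮⇒≥ λ m<n → <-irrefl refl (g m<n))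

-- `at` cannot tell an empty row from a missing one; the hypotheses on the rows exclude this
-- ambiguity.
at-ext : ∀ {T U : Raw} → NonEmptyRows T → NonEmptyRows U → (∀ i j → at T i j ≡ at U i j) → T ≡ U
at-ext {[]}    {[]}    _ _ e = refl
at-ext {[]}    {y ∷ U} _ (q ∷ _) e with z , e′ ← nth-< y q with () ← trans (e 0 0) e′
at-ext {x ∷ T} {[]}    (p ∷ _) _ e with z , e′ ← nth-< x p with () ← trans (sym (e 0 0)) e′
at-ext {x ∷ T} {y ∷ U} (_ ∷ ps) (_ ∷ qs) e = cong₂ _∷_ (nth-ext x y (e 0))
  (at-ext ps qs λ i j → trans (sym (at-suc x T i j)) (trans (e (suc i) j) (at-suc y U i j)))

-- Ferrers shape

Antitone : (ℕ → ℕ) → Set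
Antitone ℓ = ∀ {i i′} → i ≤ i′ → ℓ i′ ≤ ℓ i

antitone : ∀ (ℓ : ℕ → ℕ) → (∀ i → ℓ (suc i) ≤ ℓ i) → Antitone ℓ
antitone ℓ step {i′ = zero}  z≤n = ≤-refl
antitone ℓ step {i} {suc i′} p with m≤n⇒m<n∨m≡n p
... | inj₂ refl    = ≤-refl
... | inj₁ (s≤s q) = ≤-trans (step i′) (antitone ℓ step q)

rowLen-antitone : ∀ {T} → Linked (λ a b → b ≤ a) (map length T) → Antitone (rowLen T)
rowLen-antitone {T} l = antitone (rowLen T) (go l)
  where
  go : ∀ {T} → Linked (λ a b → b ≤ a) (map length T) → ∀ i → rowLen T (suc i) ≤ rowLen T i
  go {[]}        _       i       = z≤n
  go {x ∷ []}    _       i       = z≤n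
  go {x ∷ y ∷ T} (p ∷ _) zero    = p
  go {x ∷ y ∷ T} (_ ∷ l) (suc i) =
    subst₂ _≤_ (sym (rowLen-suc x (y ∷ T) (suc i))) (sym (rowLen-suc x (y ∷ T) i)) (go l i)

antitone-linked : ∀ {T} → Antitone (rowLen T) → Linked (λ a b → b ≤ a) (map length T)
antitone-linked {[]}        _ = []
antitone-linked {x ∷ []}    _ = [-]
antitone-linked {x ∷ y ∷ T} a = a {0} {1} z≤n ∷ antitone-linked
  λ {i} {i′} p → subst₂ _≤_ (rowLen-suc x (y ∷ T) i′) (rowLen-suc x (y ∷ T) i) (a (s≤s p))

antitone-down : ∀ {T} → Antitone (rowLen T) → Down (at T)
antitone-down {T} a p q x = <⇒cell T (≤-<-trans q (<-≤-trans (cell⇒< T x) (a p)))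

down-antitone : ∀ {T} → Down (at T) → Antitone (rowLen T)
down-antitone {T} d {i} {i′} p = ≮⇒≥ λ q → <-irrefl refl (cell⇒< T (d p ≤-refl (<⇒cell T q)))

-- Passage between `IsTLT` and `TLT`

toTLT : ∀ {n T} → IsTLT n T → TLT n (at T)
toTLT {n} {T} t = record
  { height = length T ; width = ncols T
  ; height⇒ = λ p → <⇒cell T (rowLen-pos⇐ nonEmpty p) ; height⇐ = rowLen-pos⇒ T ∘ cell⇒< T
  ; width⇒ = <⇒cell T ; width⇐ = cell⇒< T
  ; size = T.size
  ; down = antitone-down {T} (rowLen-antitone (proj₂ T.ferrers))
  ; root = T.root
  ; parent = λ {i} {j} p ≢0 → proj₁ (T.treeCond i j p ≢0)
  ; single = λ {i} {j} p ≢0 u l → proj₂ (T.treeCond i j p ≢0) (u , l)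
  ; rows = λ {i} x → T.rowCond i (rowLen-pos⇒ T (cell⇒< T x))
  ; columns = λ {j} x → T.colCond j (cell⇒< T x) }
  where
  module T = IsTLT t
  nonEmpty = proj₁ T.ferrers

fromTLT : ∀ {n T} → NonEmptyRows T → TLT n (at T) → IsTLT n T
fromTLT {n} {T} ne t = record
  { ferrers = ne , antitone-linked (down-antitone {T} T.down)
  ; size = trans (cong₂ _+_
      (<-ext (λ p → T.height⇐ (<⇒cell T (rowLen-pos⇐ ne p))) (rowLen-pos⇒ T ∘ cell⇒< T ∘ T.height⇒))
      (<-ext (T.width⇐ ∘ <⇒cell T) (cell⇒< T ∘ T.width⇒))) T.size
  ; root = T.root
  ; treeCond = λ i j p ≢0 → T.parent p ≢0 , λ (u , l) → T.single p ≢0 u l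
  ; rowCond = λ i p → T.rows (<⇒cell T (rowLen-pos⇐ ne p))
  ; colCond = λ j p → T.columns (<⇒cell T p) }
  where module T = TLT t

-- Column lengths

colLen-accept : ∀ x (T : Raw) {j} → j < length x → colLen (x ∷ T) j ≡ suc (colLen T j)
colLen-accept x T {j} p = cong length (filter-accept (λ r → j <? length r) {x} {T} p)

colLen-reject : ∀ x (T : Raw) {j} → ¬ j < length x → colLen (x ∷ T) j ≡ colLen T j
colLen-reject x T {j} p = cong length (filter-reject (λ r → j <? length r) {x} {T} p)

down-tail : ∀ {x T} → Down (at (x ∷ T)) → Down (at T)
down-tail {x} {T} d {i} {j} {i′} {j′} p q (b , e) with b′ , e′ ← d (s≤s p) q
    (b , trans (at-suc x T i j) e) =
  b′ , trans (sym (at-suc x T i′ j′)) e′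

-- `colLen` counts the rows longer than `j` wherever they stand in the list. By `Down` they form an
-- initial segment, so the count is also the index of the first row without a cell in column `j`.
cell⇒<colLen : ∀ (T : Raw) → Down (at T) → ∀ {i j} → Cell (at T) i j → i < colLen T j
cell⇒<colLen (x ∷ T) d {i} {j} c = subst (i <_) (sym (colLen-accept x T j<x)) (go i c)
  where
  j<x : j < length x
  j<x = cell⇒< (x ∷ T) {0} (d {i} {j} z≤n ≤-refl c)
  go : ∀ i → Cell (at (x ∷ T)) i j → i < suc (colLen T j)
  go zero    _       = s≤s z≤n
  go (suc k) (b , e) = s≤s (cell⇒<colLen T (down-tail {x} {T} d) (b , trans (sym (at-suc x T k j)) e))

<colLen⇒cell : ∀ (T : Raw) → Down (at T) → ∀ {i j} → i < colLen T j → Cell (at T) i j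
<colLen⇒cell (x ∷ T) d {i} {j} p with j <? length x
<colLen⇒cell (x ∷ T) d {zero}  {j} p | yes j<x = nth-< x j<x
<colLen⇒cell (x ∷ T) d {suc i} {j} p | yes j<x
  with b , e ← <colLen⇒cell T (down-tail {x} {T} d)
      (s≤s⁻¹ (subst (suc i <_) (colLen-accept x T j<x) p)) =
  b , trans (at-suc x T i j) e
<colLen⇒cell (x ∷ T) d {i} {j} p | no j≮x
  with b , e ← <colLen⇒cell T (down-tail {x} {T} d) (subst (i <_) (colLen-reject x T j≮x) p) =
  contradiction (cell⇒< (x ∷ T) {0} (d {suc i} {j} {0} {j} z≤n ≤-refl
      (b , trans (at-suc x T i j) e))) j≮x

-- The special point

cell? : ∀ (A : Grid) i j → Dec (Cell A i j)
cell? A i j with A i j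
... | just b  = yes (b , refl)
... | nothing = no λ ()

colLen-bottom : ∀ {T i j} → Down (at T) → Point (at T) i j → ¬ Cell (at T) (suc i) j →
    colLen T j ≡ suc i
colLen-bottom {T} d x ¬b = ≤-antisym (≮⇒≥ λ p → ¬b (<colLen⇒cell T d p))
                                     (cell⇒<colLen T d (point⇒cell (at T) x))

bottomPointed⇐ : ∀ {T i j} → Down (at T) → Point (at T) i j → ¬ Cell (at T) (suc i) j →
    bottomPointed T j ≡ true
bottomPointed⇐ {T} {i} {j} d x ¬b rewrite colLen-bottom {T} d x ¬b | x = refl

bottomPointed⇒ : ∀ {T j} → Down (at T) → bottomPointed T j ≡ true →
                 Point (at T) (colLen T j ∸ 1) j × ¬ Cell (at T) (suc (colLen T j ∸ 1)) j
bottomPointed⇒ {T} {j} d e = point e , λ x → <⇒≱ (cell⇒<colLen T d x) (≤-suc∸ (colLen T j))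
  where
  point : bottomPointed T j ≡ true → Point (at T) (colLen T j ∸ 1) j
  point e with at T (colLen T j ∸ 1) j
  ... | just true = refl
  ≤-suc∸ : ∀ m → m ≤ suc (m ∸ 1)
  ≤-suc∸ zero    = z≤n
  ≤-suc∸ (suc m) = ≤-refl

-- The hypothesis on points is the invariant of the scan from the right: the columns from `w` on
-- have been rejected.
specialFrom-spec : ∀ {T} → Down (at T) → ∀ w →
  (∀ {i j} → Point (at T) i j → w ≤ j → Cell (at T) (suc i) j) →
  (∃₂ λ p q → specialFrom T w ≡ just (p , q) × Special (at T) p q) ⊎
  (∀ {i j} → Point (at T) i j → Cell (at T) (suc i) j)
specialFrom-spec d zero    right = inj₂ λ x → right x z≤n
specialFrom-spec {T} d (suc w) right with bottomPointed T w in e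
... | true  = let x , ¬b = bottomPointed⇒ {T} d e in inj₁ (_ , _ , refl , mkSpecial x ¬b right)
... | false = specialFrom-spec {T} d w right′
  where
  right′ : ∀ {i j} → Point (at T) i j → w ≤ j → Cell (at T) (suc i) j
  right′ {i} {j} x w≤j with m≤n⇒m<n∨m≡n w≤j
  ... | inj₁ w<j  = right x w<j
  ... | inj₂ refl with cell? (at T) (suc i) w
  ... | yes y = y
  ... | no ¬y with () ← trans (sym (bottomPointed⇐ {T} d x ¬y)) e

-- The scan cannot fail: the last row contains a point, and a cell below it would belong to a
-- further row.
special-spec : ∀ {n T} → TLT n (at T) → ∃₂ λ p q → special T ≡ just (p , q) × Special (at T) p q
special-spec {n} {T} t with specialFrom-spec {T} T.down (ncols T)
    (λ {i} {j} x w≤j → contradiction (cell⇒< T {0} (T.down z≤n ≤-refl (point⇒cell (at T) x))) (≤⇒≯ w≤j))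
  where module T = TLT t
... | inj₁ s = s
... | inj₂ all = contradiction (T.height⇐ (point⇒cell (at T) T.root)) (last T.height refl)
  where
  module T = TLT t
  last : ∀ h → h ≡ T.height → ¬ 0 < T.height
  last zero    refl p = contradiction p λ ()
  last (suc h) refl _ = let j , x = T.rows (T.height⇒ ≤-refl) in
    <-irrefl refl (T.height⇐ (T.down ≤-refl z≤n (all x)))

-- The order of the boundary edges

infix 4 _⊢_≺_
-- The order from Southwest to Northeast. Only comparing a horizontal with a vertical edge depends
-- on the shape: `horiz c` comes before `vert r` exactly when row `r` reaches over column `c`.
data _⊢_≺_ (ℓ : ℕ → ℕ) : Edge → Edge → Set where
  hh : ∀ {c c′} → c < c′ → ℓ ⊢ horiz c ≺ horiz c′
  vv : ∀ {r r′} → r′ < r → ℓ ⊢ vert r ≺ vert r′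
  hv : ∀ {c r} → c < ℓ r → ℓ ⊢ horiz c ≺ vert r
  vh : ∀ {c r} → ℓ r ≤ c → ℓ ⊢ vert r ≺ horiz c

data Between (i w : ℕ) : Edge → Set where
  vert  : ∀ {r} → i ≤ r → Between i w (vert r)
  horiz : ∀ {c} → c < w → Between i w (horiz c)

data HorizIn (a b : ℕ) : Edge → Set where
  horiz : ∀ {c} → a ≤ c → c < b → HorizIn a b (horiz c)

hdesc-in : ∀ b k → All (HorizIn b (b + k)) (hdesc b k)
hdesc-in b zero    = []
hdesc-in b (suc k) = horiz (m≤m+n b k) (+-monoʳ-< b (n<1+n k))
  ∷ All.map (λ { (horiz p q) → horiz p (<-trans q (+-monoʳ-< b (n<1+n k))) }) (hdesc-in b k)

hdesc-∈ : ∀ {b k c} → b ≤ c → c < b + k → horiz c ∈ hdesc b k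
hdesc-∈ {b} {zero}  {c} p q = contradiction p (<⇒≱ (subst (c <_) (+-identityʳ b) q))
hdesc-∈ {b} {suc k} {c} p q with m≤n⇒m<n∨m≡n (s≤s⁻¹ (subst (c <_) (+-suc b k) q))
... | inj₁ c<  = there (hdesc-∈ p c<)
... | inj₂ refl = here refl

module _ (ℓ : ℕ → ℕ) (anti : Antitone ℓ) where

  -- The order speaks of the row lengths of the whole tableau, the recursion of `neEdges` of a tail
  -- of the list; this says that the tail begins at row `i`.
  Matches : ℕ → List ℕ → Set
  Matches i []       = ℓ i ≡ 0
  Matches i (l ∷ ls) = ℓ i ≡ l × Matches (suc i) ls

  hdesc-sorted : ∀ b k → AllPairs (flip (ℓ ⊢_≺_)) (hdesc b k)
  hdesc-sorted b zero    = []
  hdesc-sorted b (suc k) = All.map (λ { (horiz _ q) → hh q }) (hdesc-in b k) ∷ hdesc-sorted b k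

  matches-next : ∀ {i} ls → Matches i ls → ℓ i ≡ nextLen ls
  matches-next []       e       = e
  matches-next (l ∷ ls) (e , _) = e

  nextLen≤ : ∀ {i l} ls → ℓ i ≡ l → Matches (suc i) ls → nextLen ls ≤ l
  nextLen≤ {i} ls e ms = subst₂ _≤_ (matches-next ls ms) e (anti (n≤1+n i))

  neEdges-between : ∀ i ls → Matches i ls → All (Between i (nextLen ls)) (neEdges i ls)
  neEdges-between i []       _        = []
  neEdges-between i (l ∷ ls) (e , ms) = vert ≤-refl ∷ Allₚ.++⁺
    (All.map (λ { (horiz p q) → horiz (subst (_ <_) (m+[n∸m]≡n n≤l) q) })
        (hdesc-in (nextLen ls) (l ∸ nextLen ls)))
    (All.map (λ { (vert p) → vert (<⇒≤ p) ; (horiz q) → horiz (<-≤-trans q n≤l) })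
        (neEdges-between (suc i) ls ms))
    where n≤l = nextLen≤ ls e ms

  -- The order is flipped because the list starts at the Northeast end. By `neEdges-between`, the
  -- edges of the tail lie in rows from `suc i` on and in columns left of `nextLen ls`, which
  -- settles every comparison with the edges of row `i`.
  neEdges-sorted : ∀ i ls → Matches i ls → AllPairs (flip (ℓ ⊢_≺_)) (neEdges i ls)
  neEdges-sorted i []       _        = []
  neEdges-sorted i (l ∷ ls) (e , ms) =
    Allₚ.++⁺
      (All.map (λ { (horiz p q) → hv (subst (_ <_) (trans (m+[n∸m]≡n n≤l) (sym e)) q) })
          (hdesc-in (nextLen ls) (l ∸ nextLen ls)))
      (All.map (λ { (vert p) → vv p ; (horiz q) → hv (<-≤-trans q (subst (nextLen ls ≤_) (sym e) n≤l)) })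
          between)
    ∷ AllPairsₚ.++⁺ (hdesc-sorted _ _) (neEdges-sorted (suc i) ls ms)
      (All.map (λ { (horiz p q) →
          All.map (λ { (vert p′) → vh (≤-trans (below p′) p) ; (horiz q′) → hh (<-≤-trans q′ p) }) between })
        (hdesc-in (nextLen ls) (l ∸ nextLen ls)))
    where
    n≤l = nextLen≤ ls e ms
    between = neEdges-between (suc i) ls ms
    below : ∀ {r} → suc i ≤ r → ℓ r ≤ nextLen ls
    below p = subst (ℓ _ ≤_) (matches-next ls ms) (anti p)

  matches : ∀ i T → (∀ k → ℓ (i + k) ≡ rowLen T k) → Matches i (map length T)
  matches i []      e = trans (cong ℓ (sym (+-identityʳ i))) (e 0)
  matches i (x ∷ T) e = trans (cong ℓ (sym (+-identityʳ i))) (e 0) ,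
    matches (suc i) T λ k → trans (cong ℓ (sym (+-suc i k))) (trans (e (suc k)) (rowLen-suc x T k))

vert-∈ : ∀ i k ls → k < length ls → vert (i + k) ∈ neEdges i ls
vert-∈ i zero    (l ∷ ls) p       = here (cong vert (+-identityʳ i))
vert-∈ i (suc k) (l ∷ ls) (s≤s p) rewrite +-suc i k = there (∈-++⁺ʳ _ (vert-∈ (suc i) k ls p))

horiz-∈ : ∀ i ls {c} → c < nextLen ls → horiz c ∈ neEdges i ls
horiz-∈ i (l ∷ ls) {c} p with c <? nextLen ls
... | yes c<n = there (∈-++⁺ʳ _ (horiz-∈ (suc i) ls c<n))
... | no  c≮n = there (∈-++⁺ˡ (hdesc-∈ n≤c (<-≤-trans p (m≤n+m∸n l (nextLen ls)))))
  where n≤c = ≮⇒≥ c≮n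

∈-vert : ∀ i ls {r} → vert r ∈ neEdges i ls → r < i + length ls
∈-vert i (l ∷ ls) (here refl) = m<m+n i (s≤s z≤n)
∈-vert i (l ∷ ls) {r} (there x) with ∈-++⁻ (hdesc (nextLen ls) (l ∸ nextLen ls)) x
... | inj₂ y = subst (r <_) (sym (+-suc i (length ls))) (∈-vert (suc i) ls y)
... | inj₁ y with () ← All.lookup (hdesc-in (nextLen ls) (l ∸ nextLen ls)) y

reverse⁺ : ∀ {R : X → X → Set} {xs} → AllPairs (flip R) xs → AllPairs R (reverse xs)
reverse⁺ []                              = []
reverse⁺ {R = R} {x ∷ xs} (px ∷ pxs) = subst (AllPairs R) (sym (unfold-reverse x xs))
  (AllPairsₚ.++⁺ (reverse⁺ pxs) ([] ∷ []) (All.tabulate λ y → All.lookup px (Anyₚ.reverse⁻ y) ∷ []))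

edges-sorted : ∀ {T} → Antitone (rowLen T) → AllPairs (rowLen T ⊢_≺_) (edges T)
edges-sorted {T} anti = reverse⁺
  (neEdges-sorted (rowLen T) anti 0 (map length T) (matches (rowLen T) anti 0 T λ _ → refl))

nextLen-ncols : ∀ T → nextLen (map length T) ≡ ncols T
nextLen-ncols []      = refl
nextLen-ncols (x ∷ T) = refl

vert-edge : ∀ {T r} → r < length T → vert r ∈ edges T
vert-edge {T} p = Anyₚ.reverse⁺ (vert-∈ 0 _ (map length T) (subst (_ <_) (sym (length-map length T)) p))

horiz-edge : ∀ {T c} → c < ncols T → horiz c ∈ edges T
horiz-edge {T} p = Anyₚ.reverse⁺ (horiz-∈ 0 (map length T) (subst (_ <_) (sym (nextLen-ncols T)) p))

vert-edge⁻ : ∀ {T r} → vert r ∈ edges T → r < length T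
vert-edge⁻ {T} x = subst (_ <_) (length-map length T) (∈-vert 0 (map length T) (Anyₚ.reverse⁻ x))

horiz-edge⁻ : ∀ {T c} → Antitone (rowLen T) → horiz c ∈ edges T → c < ncols T
horiz-edge⁻ {T} anti x with All.lookup (neEdges-between (rowLen T) anti 0 (map length T)
                                (matches (rowLen T) anti 0 T λ _ → refl)) (Anyₚ.reverse⁻ x)
... | horiz p = subst (_ <_) (nextLen-ncols T) p

≡ᵇ-sound : ∀ m n → (m ≡ᵇ n) ≡ true → m ≡ n
≡ᵇ-sound m n e = ≡ᵇ⇒≡ m n (subst T (sym e) tt)
  where open import Data.Bool using (T)

==ᴱ-sound : ∀ e f → (e ==ᴱ f) ≡ true → e ≡ f
==ᴱ-sound (vert a)  (vert b)  eq = cong vert (≡ᵇ-sound a b eq)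
==ᴱ-sound (horiz a) (horiz b) eq = cong horiz (≡ᵇ-sound a b eq)

==ᴱ-refl : ∀ e → (e ==ᴱ e) ≡ true
==ᴱ-refl (vert a)  = dec-true (a ≟ a) refl
==ᴱ-refl (horiz a) = dec-true (a ≟ a) refl

uncons-∈ : ∀ {e f es} → (e ==ᴱ f) ≡ false → e ∈ f ∷ es → e ∈ es
uncons-∈ {e} ne (here refl) with () ← trans (sym ne) (==ᴱ-refl e)
uncons-∈     ne (there x)   = x

-- Turns the comparison of list positions in `insertPoint` into a geometric one. `AllPairs` relates
-- the head to every later edge, so no transitivity of the order is called for.
indexOf-< : ∀ {R : Edge → Edge → Set} {es e f} → AllPairs R es → e ∈ es → f ∈ es →
            indexOf e es < indexOf f es → R e f
indexOf-< {es = g ∷ es} {e} {f} (pg ∷ ps) x y lt with e ==ᴱ g in eg | f ==ᴱ g in fg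
... | true  | false with refl ← ==ᴱ-sound e g eg = All.lookup pg (uncons-∈ fg y)
... | false | false = indexOf-< ps (uncons-∈ eg x) (uncons-∈ fg y) (s≤s⁻¹ lt)

indexOf-injective : ∀ {es e f} → e ∈ es → f ∈ es → indexOf e es ≡ indexOf f es → e ≡ f
indexOf-injective {g ∷ es} {e} {f} x y eq with e ==ᴱ g in eg | f ==ᴱ g in fg
... | true  | true  = trans (==ᴱ-sound e g eg) (sym (==ᴱ-sound f g fg))
... | false | false = indexOf-injective (uncons-∈ eg x) (uncons-∈ fg y) (suc-injective eq)

-- Lines inserted in a list of rows

delete : ℕ → List X → List X
delete k       []       = []
delete zero    (x ∷ xs) = xs
delete (suc k) (x ∷ xs) = x ∷ delete k xs

nth-delete : ∀ k (xs : List X) j → nth (delete k xs) j ≡ nth xs (skip k j)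
nth-delete k       []       j       = refl
nth-delete zero    (x ∷ xs) j       = refl
nth-delete (suc k) (x ∷ xs) zero    = refl
nth-delete (suc k) (x ∷ xs) (suc j) = nth-delete k xs j

nth-insertAt : ∀ {k} x (xs : List X) → k ≤ length xs → nth (insertAt k x xs) k ≡ just x
nth-insertAt {k = zero}  x xs       _       = refl
nth-insertAt {k = suc k} x (y ∷ xs) (s≤s p) = nth-insertAt x xs p

nth-insertAt-skip : ∀ {k} x (xs : List X) → k ≤ length xs → ∀ j →
    nth (insertAt k x xs) (skip k j) ≡ nth xs j
nth-insertAt-skip {k = zero}  x xs       _       j       = refl
nth-insertAt-skip {k = suc k} x (y ∷ xs) (s≤s p) zero    = refl
nth-insertAt-skip {k = suc k} x (y ∷ xs) (s≤s p) (suc j) = nth-insertAt-skip x xs p j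

-- For the rows below an inserted column: they end at or before it, so renumbering moves only
-- positions that are already outside.
nth-skip-≥ : ∀ {k} (xs : List X) → length xs ≤ k → ∀ j → nth xs (skip k j) ≡ nth xs j
nth-skip-≥ {k = k} xs p j with j <? k
... | yes j<k = cong (nth xs) (skip-< j<k)
... | no  j≮k = trans (nth-≥ xs (≤-trans p (≤-trans k≤j
    (≤-trans (n≤1+n j) (≤-reflexive (sym (skip-≥ k≤j)))))))
                      (sym (nth-≥ xs (≤-trans p k≤j)))
  where k≤j = ≮⇒≥ j≮k

insertAt-pos : ∀ k x (xs : List X) → 1 ≤ length (insertAt k x xs)
insertAt-pos zero    x xs       = s≤s z≤n
insertAt-pos (suc k) x []       = s≤s z≤n
insertAt-pos (suc k) x (y ∷ xs) = s≤s z≤n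

insertAt-All : ∀ {P : X → Set} k {x xs} → P x → All P xs → All P (insertAt k x xs)
insertAt-All zero    px pxs        = px ∷ pxs
insertAt-All (suc k) px []         = px ∷ []
insertAt-All (suc k) px (py ∷ pxs) = py ∷ insertAt-All k px pxs

delete-All : ∀ {P : X → Set} k {xs} → All P xs → All P (delete k xs)
delete-All k       []         = []
delete-All zero    (px ∷ pxs) = pxs
delete-All (suc k) (px ∷ pxs) = px ∷ delete-All k pxs

nth-newRow-< : ∀ {c j} → j < c → nth (newRow c) j ≡ just false
nth-newRow-< {suc c} {zero}  _       = refl
nth-newRow-< {suc c} {suc j} (s≤s p) = nth-newRow-< p

nth-newRow : ∀ c → nth (newRow c) c ≡ just true
nth-newRow zero    = refl
nth-newRow (suc c) = nth-newRow c

nth-newRow-> : ∀ {c j} → c < j → nth (newRow c) j ≡ nothing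
nth-newRow-> {zero}  {suc j} _       = refl
nth-newRow-> {suc c} {suc j} (s≤s p) = nth-newRow-> p

newRow-pos : ∀ c → 1 ≤ length (newRow c)
newRow-pos zero    = s≤s z≤n
newRow-pos (suc c) = s≤s z≤n

insertIntoRow : ℕ → ℕ → ℕ → List Bool → List Bool
insertIntoRow r c i x =
  if i <ᵇ r then insertAt c false x else if i ≡ᵇ r then insertAt c true x else x

nth-colInsertFrom : ∀ r c k T i → nth (colInsertFrom r c k T) i ≡ Maybe.map
    (insertIntoRow r c (k + i)) (nth T i)
nth-colInsertFrom r c k []      i       = refl
nth-colInsertFrom r c k (x ∷ T) zero    = cong (λ i → just (insertIntoRow r c i x))
    (sym (+-identityʳ k))
nth-colInsertFrom r c k (x ∷ T) (suc i) = trans (nth-colInsertFrom r c (suc k) T i)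
  (cong (λ m → Maybe.map (insertIntoRow r c m) (nth T i)) (sym (+-suc k i)))

insertIntoRow-< : ∀ {r c i} x → i < r → insertIntoRow r c i x ≡ insertAt c false x
insertIntoRow-< {r} {c} {i} x p rewrite dec-true (i <? r) p = refl

insertIntoRow-≡ : ∀ r {c} x → insertIntoRow r c r x ≡ insertAt c true x
insertIntoRow-≡ r x rewrite dec-false (r <? r) (<-irrefl refl) | dec-true (r ≟ r) refl = refl

insertIntoRow-> : ∀ {r c i} x → r < i → insertIntoRow r c i x ≡ x
insertIntoRow-> {r} {c} {i} x p
  rewrite dec-false (i <? r) (<⇒≯ p) | dec-false (i ≟ r) (≢-sym (<⇒≢ p)) = refl

insertColumn-NonEmpty : ∀ r c k {T} → NonEmptyRows T → NonEmptyRows (colInsertFrom r c k T)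
insertColumn-NonEmpty r c k []       = []
insertColumn-NonEmpty r c k {x ∷ T} (p ∷ ps) = go ∷ insertColumn-NonEmpty r c (suc k) ps
  where
  go : 1 ≤ length (insertIntoRow r c k x)
  go with k <ᵇ r | k ≡ᵇ r
  ... | true  | _     = insertAt-pos c false x
  ... | false | true  = insertAt-pos c true x
  ... | false | false = p

insertLine-NonEmpty : ∀ {T} e → NonEmptyRows T → NonEmptyRows (insertLine T e)
insertLine-NonEmpty {T} (vert r)  ne = insertColumn-NonEmpty r (rowLen T r) 0 ne
insertLine-NonEmpty {T} (horiz c) ne = insertAt-All (colLen T c) (newRow-pos c) ne

column-inserted : ∀ {T r} → Antitone (rowLen T) → 0 < rowLen T r →
                  ColumnInserted r (rowLen T r) (at T) (at (insertLine T (vert r)))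
column-inserted {T} {r} anti pos = record
  { keep = keep
  ; above = above
  ; new = trans (at-insert r r<len) (trans (cong (λ z → nth z c) (insertIntoRow-≡ r (row r<len)))
            (nth-insertAt true (row r<len) (≤-reflexive (sym (row-len r<len)))))
  ; below = below
  ; pos = pos
  ; within = cell⇒< T
  ; full = <⇒cell T }
  where
  c = rowLen T r
  U = insertLine T (vert r)
  r<len = rowLen-pos⇒ T pos
  row : ∀ {i} → i < length T → List Bool
  row p = proj₁ (nth-< T p)
  nth-row : ∀ {i} (p : i < length T) → nth T i ≡ just (row p)
  nth-row p = proj₂ (nth-< T p)
  row-len : ∀ {i} (p : i < length T) → length (row p) ≡ rowLen T i
  row-len p = sym (rowLen-just T (nth-row p))
  at-insert : ∀ i (p : i < length T) {j} → at U i j ≡ nth (insertIntoRow r c i (row p)) j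
  at-insert i p {j} = at-just U (trans (nth-colInsertFrom r c 0 T i) (cong (Maybe.map _) (nth-row p))) j
  long : ∀ {i} (p : i < length T) → i ≤ r → c ≤ length (row p)
  long p i≤r = subst (c ≤_) (sym (row-len p)) (anti i≤r)
  short : ∀ {i} (p : i < length T) → r < i → length (row p) ≤ c
  short p r<i = subst (_≤ c) (sym (row-len p)) (anti (<⇒≤ r<i))
  at-out : ∀ i → ¬ i < length T → ∀ j → at U i j ≡ nothing
  at-out i i≮ j = at-nothing U (trans (nth-colInsertFrom r c 0 T i)
    (cong (Maybe.map (insertIntoRow r c i)) (nth-≥ T (≮⇒≥ i≮)))) j
  above : ∀ {i} → i < r → at U i c ≡ just false
  above {i} i<r = trans (at-insert i p) (trans (cong (λ z → nth z c) (insertIntoRow-< (row p) i<r))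
                    (nth-insertAt false (row p) (long p (<⇒≤ i<r))))
    where p = <-trans i<r r<len
  below : ∀ {i} → r < i → at U i c ≡ nothing
  below {i} r<i with i <? length T
  ... | no  i≮ = at-out i i≮ c
  ... | yes p = trans (at-insert i p) (trans (cong (λ z → nth z c) (insertIntoRow-> (row p) r<i))
                  (nth-≥ (row p) (short p r<i)))
  keep : ∀ i j → at U i (skip c j) ≡ at T i j
  keep i j with i <? length T
  ... | no  i≮ = trans (at-out i i≮ _) (sym (at-nothing T (nth-≥ T (≮⇒≥ i≮)) j))
  ... | yes p = trans (at-insert i p) (trans kept-row (sym (at-just T (nth-row p) j)))
    where
    kept-row : nth (insertIntoRow r c i (row p)) (skip c j) ≡ nth (row p) j
    kept-row with <-cmp i r
    ... | tri< i<r _ _ = trans (cong (λ z → nth z (skip c j)) (insertIntoRow-< (row p) i<r))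
                           (nth-insertAt-skip false (row p) (long p (<⇒≤ i<r)) j)
    ... | tri≈ _ refl _ = trans (cong (λ z → nth z (skip c j)) (insertIntoRow-≡ r (row p)))
                           (nth-insertAt-skip true (row p) (long p ≤-refl) j)
    ... | tri> _ _ r<i = trans (cong (λ z → nth z (skip c j)) (insertIntoRow-> (row p) r<i))
                           (nth-skip-≥ (row p) (short p r<i) j)

row-inserted : ∀ {T c} → Down (at T) → c < ncols T →
               ColumnInserted c (colLen T c) (flip (at T)) (flip (at (insertLine T (horiz c))))
row-inserted {T} {c} down p = record
  { keep = λ j i → at-cong U T (nth-insertAt-skip (newRow c) T R≤ i) j
  ; above = λ j<c → trans (at-just U new _) (nth-newRow-< j<c)
  ; new = trans (at-just U new c) (nth-newRow c)
  ; below = λ c<j → trans (at-just U new _) (nth-newRow-> c<j)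
  ; pos = cell⇒<colLen T down {0} (<⇒cell T p)
  ; within = cell⇒<colLen T down
  ; full = <colLen⇒cell T down }
  where
  U = insertLine T (horiz c)
  R≤ : colLen T c ≤ length T
  R≤ = length-filter (λ r → c <? length r) T
  new : nth U (colLen T c) ≡ just (newRow c)
  new = nth-insertAt (newRow c) T R≤

-- Line insertion as an invertible relation

data LineInserted (A A′ : Grid) : Edge → ℕ → ℕ → Set where
  column : ∀ {r c} → ColumnInserted r c A A′ → LineInserted A A′ (vert r) r c
  row    : ∀ {r c} → ColumnInserted c r (flip A) (flip A′) → LineInserted A A′ (horiz c) r c

insertLine-inserted : ∀ {n T e} → IsTLT n T → e ∈ edges T →
  LineInserted (at T) (at (insertLine T e)) e (proj₁ (newPoint T e)) (proj₂ (newPoint T e))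
insertLine-inserted {T = T} {vert r} t x =
  column (column-inserted {T} {r} (down-antitone {T} T.down) (cell⇒< T (T.height⇒ (vert-edge⁻ {T} x))))
  where module T = TLT (toTLT t)
insertLine-inserted {T = T} {horiz c} t x = row (row-inserted {T} T.down
    (horiz-edge⁻ {T} (down-antitone {T} T.down) x))
  where module T = TLT (toTLT t)

inserted-TLT : ∀ {n A A′ e r c} → LineInserted A A′ e r c → TLT n A → TLT (suc n) A′
inserted-TLT (column ins) t = insert-TLT ins t
inserted-TLT (row ins)    t = flip-TLT (insert-TLT ins (flip-TLT t))

inserted-Corner : ∀ {A A′ e r c} → LineInserted A A′ e r c → Corner A′ r c
inserted-Corner (column ins) = insert-Corner ins
inserted-Corner {A′ = A′} (row ins) = flip-Corner (flip A′) (insert-Corner ins)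

-- In the mixed cases the new point would have a point to its left, as the foot of an inserted
-- column, and none there, as the end of an inserted row.
inserted-injective : ∀ {m n A B A′ e f r c} → TLT m A → TLT n B →
  LineInserted A A′ e r c → LineInserted B A′ f r c → e ≡ f × ∀ i j → A i j ≡ B i j
inserted-injective s t (column a) (column b) = refl , column-unique a b
inserted-injective s t (row a)    (row b)    = refl , λ i j → column-unique a b j i
inserted-injective s t (column a) (row b)    = contradiction (point-left a s) (no-above b)
inserted-injective s t (row a)    (column b) = contradiction (point-left b t) (no-above a)

column-determined : ∀ {r c A A′ B′} → ColumnInserted r c A A′ → ColumnInserted r c A B′ → ∀ i j →
    A′ i j ≡ B′ i j
column-determined {r} {c} a b i j with skipView c j
... | kept k = trans (ColumnInserted.keep a i k) (sym (ColumnInserted.keep b i k))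
... | hole with <-cmp i r
... | tri< i<r _ _ = trans (ColumnInserted.above a i<r) (sym (ColumnInserted.above b i<r))
... | tri≈ _ refl _ = trans (ColumnInserted.new a) (sym (ColumnInserted.new b))
... | tri> _ _ r<i = trans (ColumnInserted.below a r<i) (sym (ColumnInserted.below b r<i))

at-delete-column : ∀ c (T : Raw) i j → at T i (skip c j) ≡ at (map (delete c) T) i j
at-delete-column c []      i       j = refl
at-delete-column c (x ∷ T) zero    j = sym (nth-delete c x j)
at-delete-column c (x ∷ T) (suc i) j =
  trans (at-suc x T i (skip c j)) (trans (at-delete-column c T i j)
      (sym (at-suc (delete c x) (map (delete c) T) i j)))

nonEmptyRows : ∀ T → (∀ {i} → i < length T → Cell (at T) i 0) → NonEmptyRows T
nonEmptyRows []      f = []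
nonEmptyRows (x ∷ T) f = cell⇒< (x ∷ T) {0} (f (s≤s z≤n)) ∷
  nonEmptyRows T λ {i} p → proj₁ (f (s≤s p)) , trans (sym (at-suc x T i 0)) (proj₂ (f (s≤s p)))

-- With half-perimeter at least 3 there is a second row or a second column, hence a cell below or
-- beside the root. This is where `1 ≤ n` enters: the one-cell tableau is a corner without a parent.
root-not-Corner : ∀ {n A} → TLT (suc (suc n)) A → ¬ Corner A 0 0
root-not-Corner {n} t (x , b , d) = go T.height T.width refl refl T.size
  where
  module T = TLT t
  go : ∀ h w → h ≡ T.height → w ≡ T.width → ¬ T.height + T.width ≡ suc (suc (suc n))
  go (suc (suc h)) w eh ew _ = b (T.height⇒ (subst (1 <_) eh (s≤s (s≤s z≤n))))
  go h (suc (suc w)) eh ew _ = d (T.width⇒ (subst (1 <_) ew (s≤s (s≤s z≤n))))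
  go 0 0 refl refl ()
  go 0 1 refl refl ()
  go 1 0 refl refl ()
  go 1 1 refl refl ()

corner-parent : ∀ {n A r c} → TLT (suc (suc n)) A → Corner A r c → PointAbove A r c ⊎ PointLeft A r c
corner-parent t corner@(x , _) = TLT.parent t x λ { (refl , refl) → root-not-Corner t corner }

insertLine-surjective : ∀ {n U r c} → 1 ≤ n → IsTLT (suc n) U → Corner (at U) r c →
  ∃₂ λ T e → IsTLT n T × e ∈ edges T × insertLine T e ≡ U × newPoint T e ≡ (r , c)
insertLine-surjective {suc n} {U} {r} {c} _ u corner@(x , ¬b , ¬d)
  with corner-parent (toTLT u) corner
... | inj₂ left = T , vert r , t , e∈ , insertLine≡ , cong (r ,_) len
  where
  open TLT (toTLT u)
  T = map (delete c) U
  ins : ColumnInserted r c (at T) (at U)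
  ins = column-deleted (toTLT u) corner left (at-delete-column c U)
  open ColumnInserted ins using (full; within; pos)
  len : rowLen T r ≡ c
  len = <-ext (within ∘ <⇒cell T) (cell⇒< T ∘ full)
  ne : NonEmptyRows T
  ne = nonEmptyRows T λ p → column0⁻ ins (<⇒cell U
      (rowLen-pos⇐ (proj₁ (IsTLT.ferrers u)) (subst (_ <_) (length-map (delete c) U) p)))
  t : IsTLT (suc n) T
  t = fromTLT ne (delete-TLT ins left (toTLT u))
  e∈ : vert r ∈ edges T
  e∈ = vert-edge {T} (rowLen-pos⇒ T (cell⇒< T (full pos)))
  insertLine≡ : insertLine T (vert r) ≡ U
  -- `insertLine` puts the column at `rowLen T r`, which `len` aligns with `c`; then both insertions
  -- have the same source and parameters and agree cell by cell.
  insertLine≡ = at-ext (insertLine-NonEmpty (vert r) ne) (proj₁ (IsTLT.ferrers u)) (column-determined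
    (subst (λ c → ColumnInserted r c (at T) (at (insertLine T (vert r)))) len
      (column-inserted {T} {r} (down-antitone {T} (TLT.down (toTLT t)))
          (subst (0 <_) (sym len) pos))) ins)
... | inj₁ up = T , horiz c , t , e∈ , insertLine≡ , cong (_, c) len
  where
  open TLT (toTLT u)
  T = delete r U
  ins : ColumnInserted c r (flip (at T)) (flip (at U))
  ins = column-deleted (flip-TLT (toTLT u)) (flip-Corner (at U) corner) up
      (λ j i → sym (at-cong T U (nth-delete r U i) j))
  open ColumnInserted ins using (full; within; pos)
  ne : NonEmptyRows T
  ne = delete-All r (proj₁ (IsTLT.ferrers u))
  t : IsTLT (suc n) T
  t = fromTLT ne (flip-TLT (delete-TLT ins up (flip-TLT (toTLT u))))
  len : colLen T c ≡ r
  len = <-ext (within ∘ <colLen⇒cell T (TLT.down (toTLT t)))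
      (cell⇒<colLen T (TLT.down (toTLT t)) ∘ full)
  c<w : c < ncols T
  c<w = cell⇒< T (full pos)
  e∈ : horiz c ∈ edges T
  e∈ = horiz-edge {T} c<w
  insertLine≡ : insertLine T (horiz c) ≡ U
  insertLine≡ = at-ext (insertLine-NonEmpty (horiz c) ne) (proj₁ (IsTLT.ferrers u)) λ i j →
      column-determined
    (subst (λ r → ColumnInserted c r (flip (at T)) (flip (at (insertLine T (horiz c))))) len
      (row-inserted {T} (TLT.down (toTLT t)) c<w)) ins j i

-- Ribbons

-- The comparison suited to ribbons, which alter row lengths and keep points: a cell that is present
-- but not pointed can only be `false`.
rowLen-ext : ∀ {T U : Raw} → NonEmptyRows T → NonEmptyRows U → (∀ i → rowLen T i ≡ rowLen U i) →
  (∀ {i j} → Point (at T) i j → Point (at U) i j) →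
      (∀ {i j} → Point (at U) i j → Point (at T) i j) → T ≡ U
rowLen-ext {T} {U} neT neU len f g = at-ext neT neU go
  where
  go : ∀ i j → at T i j ≡ at U i j
  go i j with at T i j in e | at U i j in e′
  ... | nothing    | nothing    = refl
  ... | nothing    | just b     = contradiction (<⇒cell T
      (subst (j <_) (sym (len i)) (cell⇒< U (b , e′)))) (no-cell (at T) e)
  ... | just b     | nothing    = contradiction (<⇒cell U (subst (j <_) (len i) (cell⇒< T (b , e))))
      (no-cell (at U) e′)
  ... | just true  | just b     = trans (sym (f e)) e′
  ... | just false | just false = refl
  ... | just false | just true  with () ← trans (sym (g e′)) e

nth-++-true : ∀ (x : List Bool) k {j} → nth (x ++ replicate k false) j ≡ just true → nth x j ≡ just true
nth-++-true []       (suc k) {suc j} e = nth-++-true [] k e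
nth-++-true (y ∷ x)  k {zero}        e = e
nth-++-true (y ∷ x)  k {suc j}       e = nth-++-true x k e

nth-++ˡ : ∀ (x y : List Bool) {j b} → nth x j ≡ just b → nth (x ++ y) j ≡ just b
nth-++ˡ (z ∷ x) y {zero}  e = e
nth-++ˡ (z ∷ x) y {suc j} e = nth-++ˡ x y e

ribbonRow : Raw → ℕ → ℕ → ℕ → ℕ → List Bool → List Bool
ribbonRow U p q a i x =
  if (i ≡ᵇ suc p) ∧ (i ≤ᵇ a) then extendTo (suc q) x
  else if (suc p <ᵇ i) ∧ (i ≤ᵇ a) then extendTo (suc (rowLen U (i ∸ 1))) x
  else x

nth-ribbonFrom : ∀ U p q a k T i → nth (ribbonFrom U p q a k T) i ≡ Maybe.map
    (ribbonRow U p q a (k + i)) (nth T i)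
nth-ribbonFrom U p q a k []      i       = refl
nth-ribbonFrom U p q a k (x ∷ T) zero    = cong (λ i → just (ribbonRow U p q a i x))
    (sym (+-identityʳ k))
nth-ribbonFrom U p q a k (x ∷ T) (suc i) = trans (nth-ribbonFrom U p q a (suc k) T i)
  (cong (λ m → Maybe.map (ribbonRow U p q a m) (nth T i)) (sym (+-suc k i)))

ribbonRow-extends : ∀ U p q a i x → ∃ λ k → ribbonRow U p q a i x ≡ x ++ replicate k false
ribbonRow-extends U p q a i x with (i ≡ᵇ suc p) ∧ (i ≤ᵇ a) | (suc p <ᵇ i) ∧ (i ≤ᵇ a)
... | true  | _     = _ , refl
... | false | true  = _ , refl
... | false | false = 0 , sym (++-identityʳ x)

ribbonRow-above : ∀ U {p} q a {i} x → i ≤ p → ribbonRow U p q a i x ≡ x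
ribbonRow-above U {p} q a {i} x i≤p
  rewrite dec-false (i ≟ suc p) (<⇒≢ (s≤s i≤p)) | dec-false (suc p <? i) (≤⇒≯ (m≤n⇒m≤1+n i≤p)) = refl

ribbonRow-below : ∀ U p q {a i} x → a < i → ribbonRow U p q a i x ≡ x
ribbonRow-below U p q {a} {i} x a<i
  rewrite dec-false (i ≤? a) (<⇒≱ a<i) | Boolₚ.∧-zeroʳ (i ≡ᵇ suc p) | Boolₚ.∧-zeroʳ (suc p <ᵇ i) = refl

ribbonRow-last : ∀ U {p} q {a} x → p < a → ribbonRow U p q a (suc p) x ≡ extendTo (suc q) x
ribbonRow-last U {p} q {a} x p<a rewrite dec-true (suc p ≟ suc p) refl | dec-true (suc p ≤? a) p<a =
    refl

ribbonRow-mid : ∀ U {p} q {a i} x → p < i → i < a →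
    ribbonRow U p q a (suc i) x ≡ extendTo (suc (rowLen U i)) x
ribbonRow-mid U {p} q {a} {i} x p<i i<a
  rewrite dec-false (suc i ≟ suc p) (≢-sym (<⇒≢ (s≤s p<i))) | dec-true (suc p <? suc i) (s≤s p<i)
  | dec-true (suc i ≤? a) i<a = refl

length-extendTo : ∀ {m} (x : List Bool) → length x ≤ m → length (extendTo m x) ≡ m
length-extendTo {m} x p = trans (length-++ x) (trans
    (cong (length x +_) (length-replicate (m ∸ length x))) (m+[n∸m]≡n p))

addRibbon-point⇒ : ∀ T {p q a i j} → Point (at (addRibbon T (p , q) a)) i j → Point (at T) i j
addRibbon-point⇒ T {p} {q} {a} {i} {j} x with nth T i in e
... | nothing with () ← trans (sym x) (at-nothing (addRibbon T (p , q) a)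
                          (trans (nth-ribbonFrom T p q a 0 T i) (cong (Maybe.map _) e)) j)
... | just r = let k , e′ = ribbonRow-extends T p q a i r in
  nth-++-true r k (trans (cong (λ z → nth z j) (sym e′))
    (trans (sym (at-just (addRibbon T (p , q) a)
      (trans (nth-ribbonFrom T p q a 0 T i) (cong (Maybe.map (ribbonRow T p q a i)) e)) j)) x))

addRibbon-point⇐ : ∀ T {p q a i j} → Point (at T) i j → Point (at (addRibbon T (p , q) a)) i j
addRibbon-point⇐ T {p} {q} {a} {i} {j} x with nth T i in e
... | just r = let k , e′ = ribbonRow-extends T p q a i r in
  trans (at-just (addRibbon T (p , q) a) (trans (nth-ribbonFrom T p q a 0 T i)
      (cong (Maybe.map (ribbonRow T p q a i)) e)) j)
    (trans (cong (λ z → nth z j) e′) (nth-++ˡ r (replicate k false) x))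

addRibbon-NonEmpty : ∀ {T p q a} → NonEmptyRows T → NonEmptyRows (addRibbon T (p , q) a)
addRibbon-NonEmpty {T} {p} {q} {a} = go 0
  where
  go : ∀ k {S} → NonEmptyRows S → NonEmptyRows (ribbonFrom T p q a k S)
  go k []              = []
  go k {x ∷ S} (l ∷ ls) = (let m , e = ribbonRow-extends T p q a k x in
    subst (λ z → 1 ≤ length z) (sym e) (subst (1 ≤_) (sym (length-++ x)) (≤-trans l (m≤m+n _ _)))) ∷
        go (suc k) ls

addRibbon-rowLen : ∀ T p q a i {x} → nth T i ≡ just x →
    rowLen (addRibbon T (p , q) a) i ≡ length (ribbonRow T p q a i x)
addRibbon-rowLen T p q a i e = rowLen-just (addRibbon T (p , q) a)
  (trans (nth-ribbonFrom T p q a 0 T i) (cong (Maybe.map (ribbonRow T p q a i)) e))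

addRibbon-rowLen-same : ∀ T p q a i → (∀ x → ribbonRow T p q a i x ≡ x) →
    rowLen (addRibbon T (p , q) a) i ≡ rowLen T i
addRibbon-rowLen-same T p q a i same = rowLen-cong (addRibbon T (p , q) a) T
  (trans (nth-ribbonFrom T p q a 0 T i) (trans (Maybeₚ.map-cong same (nth T i))
      (Maybeₚ.map-id (nth T i))))

-- Row lengths along a ribbon

-- The minimum is q for i = p, so that the ribbon ends below the special point (p , q), and ℓ i for i > p.
record RibbonShape (ℓ ℓ′ : ℕ → ℕ) (p q a : ℕ) : Set where
  field
    low  : ∀ {i} → i ≤ p → ℓ′ i ≡ ℓ i
    mid  : ∀ {i} → p ≤ i → i < a → ℓ′ (suc i) ≡ suc (q ⊓ ℓ i)
    high : ∀ {i} → a < i → ℓ′ i ≡ ℓ i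

ribbonShape-determined : ∀ {ℓ ℓ₁ ℓ₂ p q a} → RibbonShape ℓ ℓ₁ p q a → RibbonShape ℓ ℓ₂ p q a → ∀ i →
    ℓ₁ i ≡ ℓ₂ i
ribbonShape-determined {p = p} {a = a} s t i with i ≤? p | a <? i
... | yes i≤p | _       = trans (RibbonShape.low s i≤p) (sym (RibbonShape.low t i≤p))
... | no  _   | yes a<i = trans (RibbonShape.high s a<i) (sym (RibbonShape.high t a<i))
... | no  i≰p | no  a≮i with s≤s p≤i ← ≰⇒> i≰p =
  trans (RibbonShape.mid s p≤i (≮⇒≥ a≮i)) (sym (RibbonShape.mid t p≤i (≮⇒≥ a≮i)))

-- `U` is any tableau with the right row lengths and points, not literally a value of `addRibbon`,
-- so that two ribbons leading to the same `U` can be compared.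
record RibbonAdded (T U : Raw) (a b p q : ℕ) : Set where
  field
    anti    : Antitone (rowLen T)
    corner  : Corner (at T) a b
    isSpecial : Special (at T) p q
    p<a     : p < a
    b<q     : b < q
    shape   : RibbonShape (rowLen T) (rowLen U) p q a
    point⇒  : ∀ {i j} → Point (at U) i j → Point (at T) i j
    point⇐  : ∀ {i j} → Point (at T) i j → Point (at U) i j

corner-rowLen : ∀ {T a b} → Corner (at T) a b → rowLen T a ≡ suc b
corner-rowLen {T} (x , _ , ¬d) = ≤-antisym (≮⇒≥ (¬d ∘ <⇒cell T)) (cell⇒< T (point⇒cell (at T) x))

addRibbon-added : ∀ {T a b p q} → Antitone (rowLen T) → Corner (at T) a b → Special (at T) p q →
    p < a → b < q →
  RibbonAdded T (addRibbon T (p , q) a) a b p q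
addRibbon-added {T} {a} {b} {p} {q} anti corner sp p<a b<q = record
  { anti = anti ; corner = corner ; isSpecial = sp ; p<a = p<a ; b<q = b<q
  ; shape = record
    { low  = λ {i} i≤p → addRibbon-rowLen-same T p q a i λ x → ribbonRow-above T q a x i≤p
    ; mid  = mid
    ; high = λ {i} a<i → addRibbon-rowLen-same T p q a i λ x → ribbonRow-below T p q x a<i }
  ; point⇒ = addRibbon-point⇒ T ; point⇐ = addRibbon-point⇐ T }
  where
  open Special sp
  U = addRibbon T (p , q) a
  a<len : a < length T
  a<len = rowLen-pos⇒ T (subst (0 <_) (sym (corner-rowLen {T} corner)) (s≤s z≤n))
  below≤q : rowLen T (suc p) ≤ q
  below≤q = ≮⇒≥ (bottom ∘ <⇒cell T)
  mid : ∀ {i} → p ≤ i → i < a → rowLen U (suc i) ≡ suc (q ⊓ rowLen T i)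
  mid {i} p≤i i<a with x , e ← nth-< T (≤-<-trans i<a a<len) with m≤n⇒m<n∨m≡n p≤i
  ... | inj₂ refl = trans (addRibbon-rowLen T p q a (suc p) e)
      (trans (cong length (ribbonRow-last T q x i<a))
    (trans (length-extendTo x (m≤n⇒m≤1+n (subst (_≤ q) (rowLen-just T e) below≤q)))
      (cong suc (sym (m≤n⇒m⊓n≡m (<⇒≤ (cell⇒< T (point⇒cell (at T) point))))))))
  ... | inj₁ p<i = trans (addRibbon-rowLen T p q a (suc i) e)
      (trans (cong length (ribbonRow-mid T q x p<i i<a))
    (trans (length-extendTo x (m≤n⇒m≤1+n (subst (_≤ rowLen T i) (rowLen-just T e) (anti (n≤1+n i)))))
      (cong suc (sym (m≥n⇒m⊓n≡n (≤-trans (anti p<i) below≤q))))))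

-- The tree conditions involve points only, and the half-perimeter is read off row 0 and column 0. A
-- ribbon touches neither: it starts no new row and does not widen row 0.
reshape-TLT : ∀ {n A B} → TLT n A → Down B →
  (∀ {i j} → Point A i j → Point B i j) → (∀ {i j} → Point B i j → Point A i j) →
  (∀ {i} → Cell A i 0 → Cell B i 0) → (∀ {i} → Cell B i 0 → Cell A i 0) →
  (∀ {j} → Cell A 0 j → Cell B 0 j) → (∀ {j} → Cell B 0 j → Cell A 0 j) → TLT n B
reshape-TLT t d f g c0⇒ c0⇐ r0⇒ r0⇐ = record
  { height = height ; width = width
  ; height⇒ = c0⇒ ∘ height⇒ ; height⇐ = height⇐ ∘ c0⇐
  ; width⇒ = r0⇒ ∘ width⇒ ; width⇐ = width⇐ ∘ r0⇐
  ; size = size ; down = d ; root = f root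
  ; parent = λ x ≢0 → Sum.map (λ (_ , p , y) → _ , p , f y) (λ (_ , p , y) → _ , p , f y)
      (parent (g x) ≢0)
  ; single = λ x ≢0 (_ , p , y) (_ , q , z) → single (g x) ≢0 (_ , p , g y) (_ , q , g z)
  ; rows = λ x → let j , y = rows (c0⇐ x) in j , f y
  ; columns = λ x → let i , y = columns (r0⇐ x) in i , f y }
  where
  open TLT t

module _ {T U a b p q} (added : RibbonAdded T U a b p q) where
  open RibbonAdded added
  open RibbonShape shape
  open Special isSpecial
  private
    ℓ = rowLen T
    ℓ′ = rowLen U

  special-below : ℓ (suc p) ≤ q
  special-below = ≮⇒≥ (bottom ∘ <⇒cell T)

  special-row : q < ℓ p
  special-row = cell⇒< T (point⇒cell (at T) point)

  ribbon-≤ : ∀ i → ℓ i ≤ ℓ′ i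
  ribbon-≤ i with i ≤? p | a <? i
  ... | yes i≤p | _       = ≤-reflexive (sym (low i≤p))
  ... | no  _   | yes a<i = ≤-reflexive (sym (high a<i))
  ... | no  i≰p | no  a≮i with s≤s {n = i′} p≤i ← ≰⇒> i≰p = subst (ℓ i ≤_) (sym (mid p≤i (≮⇒≥ a≮i)))
    (m≤n⇒m≤1+n (⊓-glb (≤-trans (anti (s≤s p≤i)) special-below) (anti (n≤1+n i′))))

  ribbon-antitone : Antitone ℓ′
  ribbon-antitone = antitone ℓ′ step
    where
    step : ∀ i → ℓ′ (suc i) ≤ ℓ′ i
    step i with suc i ≤? p | i <? a
    ... | yes si≤p | _ = subst₂ _≤_ (sym (low si≤p)) (sym (low (<⇒≤ si≤p))) (anti (n≤1+n i))
    ... | no _ | no  i≮a = ≤-trans (≤-reflexive (high (s≤s (≮⇒≥ i≮a))))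
        (≤-trans (anti (n≤1+n i)) (ribbon-≤ i))
    ... | no si≰p | yes i<a with p≤i ← s≤s⁻¹ (≰⇒> si≰p) with m≤n⇒m<n∨m≡n p≤i
    -- The top row of the ribbon ends at column `q`, which row `p` covers because it contains the
    -- special point.
    ... | inj₂ refl = subst₂ _≤_ (sym (mid p≤i i<a)) (sym (low ≤-refl))
        (≤-<-trans (m⊓n≤m q (ℓ i)) special-row)
    ... | inj₁ (s≤s {n = i′} p≤i′) = subst₂ _≤_ (sym (mid p≤i i<a)) (sym (mid p≤i′ (<⇒≤ i<a)))
      (s≤s (⊓-monoʳ-≤ q (anti (n≤1+n i′))))

  ribbon-TLT : ∀ {n} → TLT n (at T) → TLT n (at U)
  ribbon-TLT t = reshape-TLT t (antitone-down {U} ribbon-antitone) point⇐ point⇒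
    (λ {i} x → <⇒cell U (<-≤-trans (cell⇒< T x) (ribbon-≤ i)))
    (λ {i} x → <⇒cell T (positive i (cell⇒< U x)))
    (λ x → <⇒cell U (subst (_ <_) (sym (low z≤n)) (cell⇒< T x)))
    (λ x → <⇒cell T (subst (_ <_) (low z≤n) (cell⇒< U x)))
    where
    positive : ∀ i → 0 < ℓ′ i → 0 < ℓ i
    positive i pos with a <? i
    ... | yes a<i = subst (0 <_) (high a<i) pos
    ... | no  a≮i = <-≤-trans (s≤s z≤n) (subst (_≤ ℓ i) (corner-rowLen {T} corner) (anti (≮⇒≥ a≮i)))

  -- A point right of `q` has a cell below already in `T`. For a point in a column after `b` and up
  -- to `q`, there are three ranges: rows from `a` on have no such cell, rows from `p` to above `a`
  -- get a cell below from the ribbon, and under rows above `p` the next row is at least as long as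
  -- row `p`, which reaches `q`.
  ribbon-special : Special (at U) a b
  ribbon-special = mkSpecial (point⇐ (proj₁ corner))
    (λ x → proj₁ (proj₂ corner) (<⇒cell T (subst (b <_) (high ≤-refl) (cell⇒< U x)))) right
    where
    right : ∀ {i j} → Point (at U) i j → b < j → Cell (at U) (suc i) j
    right {i} {j} x b<j with y ← point⇒ x with q <? j
    ... | yes q<j = <⇒cell U (<-≤-trans (cell⇒< T (rightmost y q<j)) (ribbon-≤ (suc i)))
    ... | no  q≮j with i <? a | p ≤? i
    ... | no i≮a | _ = contradiction (antitone-down {T} anti (≮⇒≥ i≮a) b<j (point⇒cell (at T) y))
        (proj₂ (proj₂ corner))
    ... | yes i<a | yes p≤i = <⇒cell U (subst (j <_) (sym (mid p≤i i<a))
      (s≤s (⊓-glb (≮⇒≥ q≮j) (<⇒≤ (cell⇒< T (point⇒cell (at T) y))))))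
    ... | yes i<a | no  p≰i = <⇒cell U (<-≤-trans (≤-<-trans (≮⇒≥ q≮j)
        (<-≤-trans special-row (anti (≰⇒> p≰i)))) (ribbon-≤ (suc i)))

  -- The trace by which `U` shows that a ribbon was added: `T` has no cell beside the corner.
  ribbon-beside : Cell (at U) a (suc b)
  ribbon-beside with s≤s {n = a′} p≤a′ ← p<a = <⇒cell U (subst (suc b <_) (sym (mid p≤a′ ≤-refl))
    (s≤s (⊓-glb b<q (subst (_≤ ℓ a′) (corner-rowLen {T} corner) (anti (n≤1+n a′))))))

  ribbon-end : ℓ′ (suc p) ≡ suc q
  ribbon-end = trans (mid ≤-refl p<a) (cong suc (m≤n⇒m⊓n≡m (<⇒≤ special-row)))

-- Suppose `p < p′`. Comparing the lengths of row `suc p′` gives `q′` as the minimum of `q` and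
-- `rowLen T p′`. But `(p′ , q′)` is a point of `T` as well, so `q′` is less than that row length
-- and the minimum is `q`; then row `p′` of `T` reaches column `q` below its lowest cell `(p , q)`.
ribbon-unique-row : ∀ {T T′ U a b p q p′ q′} → RibbonAdded T U a b p q →
    RibbonAdded T′ U a b p′ q′ → ¬ p < p′
ribbon-unique-row {T} {T′} {U} {a} {b} {p} {q} {p′} {q′} r r′ p<p′ = R.isSpecial .Special.bottom
  (antitone-down {T} R.anti p<p′ ≤-refl (<⇒cell T q<ℓp′))
  where
  module R = RibbonAdded r
  module R′ = RibbonAdded r′
  q′≡ : q ⊓ rowLen T p′ ≡ q′
  q′≡ = suc-injective (trans (sym (RibbonShape.mid R.shape (<⇒≤ p<p′) R′.p<a)) (ribbon-end r′))
  q′<ℓp′ : q′ < rowLen T p′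
  q′<ℓp′ = cell⇒< T (point⇒cell (at T) (R.point⇒ (R′.point⇐ (Special.point R′.isSpecial))))
  q<ℓp′ : q < rowLen T p′
  q<ℓp′ = ≰⇒> λ ℓ≤q → <-irrefl (trans (sym q′≡) (m≥n⇒m⊓n≡n ℓ≤q)) q′<ℓp′

-- Once the ends agree, `U` determines the shape: row `i` strictly between `p` and `a` is one
-- shorter than row `suc i` of `U`, row `a` ends at the corner, and the other rows are unchanged.
ribbon-unique : ∀ {T T′ U a b p q p′ q′} → RibbonAdded T U a b p q → RibbonAdded T′ U a b p′ q′ →
  ∀ i → rowLen T i ≡ rowLen T′ i
ribbon-unique {T} {T′} {U} {a} {b} {p} {q} {p′} {q′} r r′ i with <-cmp p p′
... | tri< p<p′ _ _ = contradiction p<p′ (ribbon-unique-row r r′)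
... | tri> _ _ p′<p = contradiction p′<p (ribbon-unique-row r′ r)
... | tri≈ _ refl _ with refl ← suc-injective (trans (sym (ribbon-end r)) (ribbon-end r′)) = go
  where
  module R = RibbonAdded r
  module R′ = RibbonAdded r′
  mid : ∀ {V} (v : RibbonAdded V U a b p q) → p < i → i < a → rowLen U (suc i) ≡ suc (rowLen V i)
  mid v p<i i<a = trans (RibbonShape.mid V.shape (<⇒≤ p<i) i<a)
    (cong suc (m≥n⇒m⊓n≡n (≤-trans (V.anti p<i) (special-below v))))
    where module V = RibbonAdded v
  go : rowLen T i ≡ rowLen T′ i
  go with i ≤? p | <-cmp i a
  ... | yes i≤p | _             = trans (sym (RibbonShape.low R.shape i≤p))
      (RibbonShape.low R′.shape i≤p)
  ... | no  _   | tri> _ _ a<i  = trans (sym (RibbonShape.high R.shape a<i))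
      (RibbonShape.high R′.shape a<i)
  ... | no  _   | tri≈ _ refl _ = trans (corner-rowLen {T} R.corner)
      (sym (corner-rowLen {T′} R′.corner))
  ... | no  i≰p | tri< i<a _ _  = suc-injective (trans (sym (mid r (≰⇒> i≰p) i<a))
      (mid r′ (≰⇒> i≰p) i<a))

-- Removing a ribbon

takeRows : (ℕ → ℕ) → Raw → Raw
takeRows ℓ []      = []
takeRows ℓ (x ∷ T) = take (ℓ 0) x ∷ takeRows (ℓ ∘ suc) T

length-takeRows : ∀ ℓ T → length (takeRows ℓ T) ≡ length T
length-takeRows ℓ []      = refl
length-takeRows ℓ (x ∷ T) = cong suc (length-takeRows (ℓ ∘ suc) T)

rowLen-takeRows : ∀ ℓ T i → ℓ i ≤ rowLen T i → rowLen (takeRows ℓ T) i ≡ ℓ i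
rowLen-takeRows ℓ []      i       p = sym (n≤0⇒n≡0 p)
rowLen-takeRows ℓ (x ∷ T) zero    p = trans (length-take (ℓ 0) x) (m≤n⇒m⊓n≡m p)
rowLen-takeRows ℓ (x ∷ T) (suc i) p = trans (rowLen-suc (take (ℓ 0) x) (takeRows (ℓ ∘ suc) T) i)
  (rowLen-takeRows (ℓ ∘ suc) T i (subst (ℓ (suc i) ≤_) (rowLen-suc x T i) p))

nth-take : ∀ {A : Set} m (x : List A) {j} → j < m → nth (take m x) j ≡ nth x j
nth-take (suc m) []      _               = refl
nth-take (suc m) (y ∷ x) {zero}  _       = refl
nth-take (suc m) (y ∷ x) {suc j} (s≤s p) = nth-take m x p

at-takeRows : ∀ ℓ T {i j} → j < ℓ i → at (takeRows ℓ T) i j ≡ at T i j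
at-takeRows ℓ []      p = refl
at-takeRows ℓ (x ∷ T) {zero}      p = nth-take (ℓ 0) x p
at-takeRows ℓ (x ∷ T) {suc i} {j} p = trans (at-suc (take (ℓ 0) x) (takeRows (ℓ ∘ suc) T) i j)
  (trans (at-takeRows (ℓ ∘ suc) T p) (sym (at-suc x T i j)))

point? : ∀ (A : Grid) i j → Dec (Point A i j)
point? A i j = Maybeₚ.≡-dec Boolₚ._≟_ (A i j) (just true)

greatest-below : ∀ {Q : ℕ → Set} → (∀ i → Dec (Q i)) → ∀ a →
  (∃ λ p → p < a × Q p × (∀ {i} → p < i → i < a → ¬ Q i)) ⊎ (∀ {i} → i < a → ¬ Q i)
greatest-below Q? zero = inj₂ λ ()
greatest-below {Q} Q? (suc a) with Q? a
... | yes q = inj₁ (a , ≤-refl , q , λ a<i i<sa → contradiction a<i (≤⇒≯ (s≤s⁻¹ i<sa)))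
... | no ¬q with greatest-below Q? a
... | inj₁ (p , p<a , q , max) = inj₁ (p , m<n⇒m<1+n p<a , q , λ {i} p<i i<sa →
    extend p<i (m≤n⇒m<n∨m≡n (s≤s⁻¹ i<sa)))
  where
  extend : ∀ {i} → p < i → i < a ⊎ i ≡ a → ¬ Q i
  extend p<i (inj₁ i<a)  = max p<i i<a
  extend p<i (inj₂ refl) = ¬q
... | inj₂ none = inj₂ λ {i} i<sa → extend (m≤n⇒m<n∨m≡n (s≤s⁻¹ i<sa))
  where
  extend : ∀ {i} → i < a ⊎ i ≡ a → ¬ Q i
  extend (inj₁ i<a)  = none i<a
  extend (inj₂ refl) = ¬q

module _ {n U a b} (neU : NonEmptyRows U) (u : TLT n (at U)) (sp : Special (at U) a b)
    (beside : Cell (at U) a (suc b)) where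
  open Special sp
  private
    module U = TLT u
    -- `d i` is the last column of row `suc i`. It is also the length to which row `i` has to be cut
    -- back inside the ribbon, since the ribbon makes row `suc i` one longer than row `i` was.
    ℓ′ d : ℕ → ℕ
    ℓ′ = rowLen U
    d i = ℓ′ (suc i) ∸ 1

    anti′ : Antitone ℓ′
    anti′ = down-antitone {U} U.down

    PointAboveEnd : ℕ → Set
    PointAboveEnd i = Point (at U) i (d i)

    below≤b : ℓ′ (suc a) ≤ b
    below≤b = ≮⇒≥ (bottom ∘ <⇒cell U)

    beside< : ∀ {i} → i < a → suc b < ℓ′ (suc i)
    beside< i<a = <-≤-trans (cell⇒< U beside) (anti′ i<a)

    suc-d : ∀ {i} → i < a → suc (d i) ≡ ℓ′ (suc i)
    suc-d i<a = m+[n∸m]≡n (<-trans (s≤s z≤n) (beside< i<a))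

    b<d : ∀ {i} → i < a → b < d i
    b<d {i} i<a = s≤s⁻¹ (subst (suc b <_) (sym (suc-d i<a)) (beside< i<a))

    -- The last column has a point, and it lies strictly above the bottom because
    -- the column is to the right of the special point.
    ribbon-end-exists : ¬ (∀ {i} → i < a → ¬ PointAboveEnd i)
    ribbon-end-exists none = go U.width refl
      where
      go : ∀ w → w ≢ U.width
      go zero    eq = contradiction (U.width⇐ (U.down z≤n ≤-refl beside))
          (subst (λ w → ¬ suc b < w) eq λ ())
      go (suc w) eq with i , x ← U.columns (U.width⇒ (subst (w <_) eq ≤-refl)) =
        none i<a (subst (Point (at U) i) (sym (cong (_∸ 1) ℓ′≡)) x)
        where
        b<w : b < w
        b<w = s≤s⁻¹ (subst (suc b <_) (sym eq) (U.width⇐ (U.down z≤n ≤-refl beside)))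
        under : Cell (at U) (suc i) w
        under = rightmost x b<w
        ℓ′≡ : ℓ′ (suc i) ≡ suc w
        ℓ′≡ = ≤-antisym (≮⇒≥ λ sw< → <-irrefl eq (U.width⇐ (U.down z≤n ≤-refl (<⇒cell U sw<))))
            (cell⇒< U under)
        i<a : i < a
        i<a = ≮⇒≥ λ a<si → bottom (U.down a<si (<⇒≤ b<w) under)

    module Removal {p} (p<a : p < a) (end : PointAboveEnd p)
        (max : ∀ {i} → p < i → i < a → ¬ PointAboveEnd i) where
      q : ℕ
      q = d p

      -- The row lengths of the tableau without the ribbon, found by solving the equations of
      -- `RibbonShape`; row `a` is cut right after the special point.
      ℓ : ℕ → ℕ
      ℓ i with i ≤? p | <-cmp i a
      ... | yes _ | _          = ℓ′ i
      ... | no _  | tri< _ _ _ = d i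
      ... | no _  | tri≈ _ _ _ = suc b
      ... | no _  | tri> _ _ _ = ℓ′ i

      ℓ-low : ∀ {i} → i ≤ p → ℓ i ≡ ℓ′ i
      ℓ-low {i} i≤p with i ≤? p | <-cmp i a
      ... | yes _   | _ = refl
      ... | no  i≰p | _ = contradiction i≤p i≰p

      ℓ-mid : ∀ {i} → p < i → i < a → ℓ i ≡ d i
      ℓ-mid {i} p<i i<a with i ≤? p | <-cmp i a
      ... | yes i≤p | _            = contradiction i≤p (<⇒≱ p<i)
      ... | no _    | tri< _ _ _   = refl
      ... | no _    | tri≈ i≮a _ _ = contradiction i<a i≮a
      ... | no _    | tri> i≮a _ _ = contradiction i<a i≮a

      ℓ-a : ℓ a ≡ suc b
      ℓ-a with a ≤? p | <-cmp a a
      ... | yes a≤p | _             = contradiction a≤p (<⇒≱ p<a)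
      ... | no _    | tri< _ a≢a _  = contradiction refl a≢a
      ... | no _    | tri≈ _ _ _    = refl
      ... | no _    | tri> _ a≢a _  = contradiction refl a≢a

      ℓ-high : ∀ {i} → a < i → ℓ i ≡ ℓ′ i
      ℓ-high {i} a<i with i ≤? p | <-cmp i a
      ... | yes _ | _            = refl
      ... | no _  | tri< _ _ a≮i = contradiction a<i a≮i
      ... | no _  | tri≈ _ _ a≮i = contradiction a<i a≮i
      ... | no _  | tri> _ _ _   = refl

      data Zone (i : ℕ) : Set where
        low  : i ≤ p → Zone i
        mid  : p < i → i < a → Zone i
        last : i ≡ a → Zone i
        high : a < i → Zone i

      zone : ∀ i → Zone i
      zone i with i ≤? p | <-cmp i a
      ... | yes i≤p | _             = low i≤p
      ... | no  i≰p | tri< i<a _ _  = mid (≰⇒> i≰p) i<a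
      ... | no  _   | tri≈ _ refl _ = last refl
      ... | no  _   | tri> _ _ a<i  = high a<i

      ℓ≤ℓ′ : ∀ i → ℓ i ≤ ℓ′ i
      ℓ≤ℓ′ i with zone i
      ... | low i≤p     = ≤-reflexive (ℓ-low i≤p)
      ... | high a<i    = ≤-reflexive (ℓ-high a<i)
      ... | last refl   = ≤-trans (≤-reflexive ℓ-a) (<⇒≤ (cell⇒< U beside))
      ... | mid p<i i<a = ≤-trans (≤-reflexive (ℓ-mid p<i i<a))
          (≤-trans (m∸n≤m (ℓ′ (suc i)) 1) (anti′ (n≤1+n i)))

      -- Used twice: in the middle rows it is the descent of `ℓ`, and at `i = p` it shows that the
      -- removal uncovers the bottom of `(p , q)`.
      ℓ-next : ∀ {i} → p ≤ i → i < a → ℓ (suc i) ≤ d i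
      ℓ-next {i} p≤i i<a with m≤n⇒m<n∨m≡n i<a
      ... | inj₁ si<a = ≤-trans (≤-reflexive (ℓ-mid (s≤s p≤i) si<a))
          (∸-monoˡ-≤ 1 (anti′ (n≤1+n (suc i))))
      ... | inj₂ refl = ≤-trans (≤-reflexive ℓ-a) (b<d i<a)

      ℓ-anti : Antitone ℓ
      ℓ-anti = antitone ℓ step
        where
        step : ∀ i → ℓ (suc i) ≤ ℓ i
        step i with zone i
        ... | low i≤p     = ≤-trans (ℓ≤ℓ′ (suc i))
            (≤-trans (anti′ (n≤1+n i)) (≤-reflexive (sym (ℓ-low i≤p))))
        ... | high a<i    = ≤-trans (ℓ≤ℓ′ (suc i))
            (≤-trans (anti′ (n≤1+n i)) (≤-reflexive (sym (ℓ-high a<i))))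
        ... | last refl   = ≤-trans (ℓ≤ℓ′ (suc i))
            (≤-trans below≤b (≤-trans (n≤1+n b) (≤-reflexive (sym ℓ-a))))
        ... | mid p<i i<a = ≤-trans (ℓ-next (<⇒≤ p<i) i<a) (≤-reflexive (sym (ℓ-mid p<i i<a)))

      -- No removed cell is pointed. In a middle row, a point at column `d i` contradicts the choice
      -- of `p` as greatest, and one further right would need a cell below it past the end of row
      -- `suc i`. In row `a`, a point right of `b` would have a cell below it, hence `(a , b)` would
      -- too.
      point-kept : ∀ {i j} → Point (at U) i j → j < ℓ i
      point-kept {i} {j} x with zone i
      ... | low i≤p     = subst (j <_) (sym (ℓ-low i≤p)) (cell⇒< U (point⇒cell (at U) x))
      ... | high a<i    = subst (j <_) (sym (ℓ-high a<i)) (cell⇒< U (point⇒cell (at U) x))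
      ... | last refl   = subst (j <_) (sym ℓ-a) (≮⇒≥ λ b<j →
          bottom (U.down ≤-refl (<⇒≤ (s≤s⁻¹ b<j)) (rightmost x (s≤s⁻¹ b<j))))
      ... | mid p<i i<a = subst (j <_) (sym (ℓ-mid p<i i<a)) (≰⇒> ¬d≤j)
        where
        ¬d≤j : ¬ d i ≤ j
        ¬d≤j d≤j with m≤n⇒m<n∨m≡n d≤j
        ... | inj₂ refl = max p<i i<a x
        ... | inj₁ d<j  = <⇒≱ (cell⇒< U (rightmost x (<-trans (b<d i<a) d<j)))
            (subst (_≤ j) (suc-d i<a) d<j)

      T : Raw
      T = takeRows ℓ U

      rowLen-T : ∀ i → rowLen T i ≡ ℓ i
      rowLen-T i = rowLen-takeRows ℓ U i (ℓ≤ℓ′ i)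

      point⇐ : ∀ {i j} → Point (at U) i j → Point (at T) i j
      point⇐ x = trans (at-takeRows ℓ U (point-kept x)) x

      point⇒ : ∀ {i j} → Point (at T) i j → Point (at U) i j
      point⇒ {i} x = trans (sym (at-takeRows ℓ U (subst (_ <_) (rowLen-T i)
          (cell⇒< T (point⇒cell (at T) x))))) x

      anti : Antitone (rowLen T)
      anti {i} {i′} p = subst₂ _≤_ (sym (rowLen-T i′)) (sym (rowLen-T i)) (ℓ-anti p)

      q-row : ℓ′ (suc p) ≡ suc q
      q-row = sym (suc-d p<a)

      isSpecial : Special (at T) p q
      isSpecial = mkSpecial (point⇐ end)
        (λ x → <⇒≱ (subst (q <_) (rowLen-T (suc p)) (cell⇒< T x)) (ℓ-next ≤-refl p<a)) right
        where
        right : ∀ {i j} → Point (at T) i j → q < j → Cell (at T) (suc i) j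
        right {i} {j} x q<j with under ← cell⇒< U (rightmost (point⇒ x) (<-trans (b<d p<a) q<j))
            with suc i ≤? p
        ... | yes si≤p = <⇒cell T (subst (j <_) (sym (trans (rowLen-T (suc i)) (ℓ-low si≤p))) under)
        -- In `U` the rows from `suc p` on reach at most column `q`, so a cell right of `q` cannot
        -- lie there.
        ... | no  si≰p = contradiction (<-≤-trans under
            (subst (ℓ′ (suc i) ≤_) q-row (anti′ (≰⇒> si≰p)))) (≤⇒≯ q<j)

      corner : Corner (at T) a b
      corner = point⇐ point
        , (λ x → <⇒≱ (subst (b <_) (trans (rowLen-T (suc a)) (ℓ-high ≤-refl)) (cell⇒< T x)) below≤b)
        , (λ x → <-irrefl refl (subst (suc b <_) (trans (rowLen-T a) ℓ-a) (cell⇒< T x)))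

      shape : RibbonShape (rowLen T) ℓ′ p q a
      shape = record
        { low  = λ {i} i≤p → sym (trans (rowLen-T i) (ℓ-low i≤p))
        ; mid  = λ {i} p≤i i<a → trans (sym (suc-d i<a))
            (cong suc (trans (d≡ p≤i i<a) (cong (q ⊓_) (sym (rowLen-T i)))))
        ; high = λ {i} a<i → sym (trans (rowLen-T i) (ℓ-high a<i)) }
        where
        d≡ : ∀ {i} → p ≤ i → i < a → d i ≡ q ⊓ ℓ i
        d≡ {i} p≤i i<a with m≤n⇒m<n∨m≡n p≤i
        ... | inj₁ p<i  = trans (sym (m≥n⇒m⊓n≡n (∸-monoˡ-≤ 1 (anti′ (s≤s p≤i)))))
            (cong (q ⊓_) (sym (ℓ-mid p<i i<a)))
        ... | inj₂ refl = sym (m≤n⇒m⊓n≡m (subst (q ≤_) (sym (ℓ-low ≤-refl))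
                            (≤-trans (m∸n≤m (ℓ′ (suc p)) 1) (anti′ (n≤1+n p)))))

      positive : ∀ i → 0 < ℓ′ i → 0 < ℓ i
      positive i pos with zone i
      ... | low i≤p     = subst (0 <_) (sym (ℓ-low i≤p)) pos
      ... | high a<i    = subst (0 <_) (sym (ℓ-high a<i)) pos
      ... | last refl   = subst (0 <_) (sym ℓ-a) (s≤s z≤n)
      ... | mid p<i i<a = subst (0 <_) (sym (ℓ-mid p<i i<a)) (≤-<-trans z≤n (b<d i<a))

      isTLT : TLT n (at T)
      isTLT = reshape-TLT u (antitone-down {T} anti) point⇐ point⇒
        (λ {i} x → <⇒cell T (subst (0 <_) (sym (rowLen-T i)) (positive i (cell⇒< U x))))
        (λ {i} x → <⇒cell U (<-≤-trans (subst (0 <_) (rowLen-T i) (cell⇒< T x)) (ℓ≤ℓ′ i)))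
        (λ {j} x → <⇒cell T (subst (j <_) (sym (trans (rowLen-T 0) (ℓ-low z≤n))) (cell⇒< U x)))
        (λ {j} x → <⇒cell U (subst (j <_) (trans (rowLen-T 0) (ℓ-low z≤n)) (cell⇒< T x)))

      nonEmpty : NonEmptyRows T
      nonEmpty = nonEmptyRows T λ {i} i< → <⇒cell T (subst (0 <_) (sym (rowLen-T i))
        (positive i (rowLen-pos⇐ neU (subst (i <_) (length-takeRows ℓ U) i<))))

      -- `RibbonShape` determines the new row lengths from the old ones, and `U` satisfies it as
      -- much as the recomputed tableau does.
      addRibbon≡ : addRibbon T (p , q) a ≡ U
      addRibbon≡ = rowLen-ext (addRibbon-NonEmpty nonEmpty) neU
        (ribbonShape-determined (RibbonAdded.shape added) shape) (point⇒ ∘ RibbonAdded.point⇒ added)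
            (RibbonAdded.point⇐ added ∘ point⇐)
        where added = addRibbon-added {T} anti corner isSpecial p<a (b<d p<a)

  remove-ribbon : ∃ λ T → ∃₂ λ p q → NonEmptyRows T × TLT n (at T) × Corner (at T) a b ×
    Special (at T) p q × p < a × b < q × addRibbon T (p , q) a ≡ U
  remove-ribbon with greatest-below (λ i → point? (at U) i (d i)) a
  ... | inj₂ none = ⊥-elim (ribbon-end-exists none)
  ... | inj₁ (p , p<a , end , max) =
    R.T , p , R.q , R.nonEmpty , R.isTLT , R.corner , R.isSpecial , p<a , b<d p<a , R.addRibbon≡
    where module R = Removal p<a end max

-- Insertpoint

-- The second half of `insertPoint`, with the edge forgotten and only the marked corner `(a , b)`
-- left. This allows the ribbon to be removed before any edge is known.
data Ribboned (T : Raw) (a b : ℕ) (U : Raw) : Set where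
  none : Special (at T) a b → T ≡ U → Ribboned T a b U
  some : ∀ {p q} → Special (at T) p q → p < a → b < q → addRibbon T (p , q) a ≡ U → Ribboned T a b U

module _ {T a b} (anti : Antitone (rowLen T)) (corner : Corner (at T) a b) where

  ribboned-special : ∀ {U} → Ribboned T a b U → Special (at U) a b
  ribboned-special (none sp refl)         = sp
  ribboned-special (some sp p<a b<q refl) = ribbon-special (addRibbon-added {T} anti corner sp p<a b<q)

  ribboned-TLT : ∀ {n U} → TLT n (at T) → Ribboned T a b U → TLT n (at U)
  ribboned-TLT t (none sp refl)         = t
  ribboned-TLT t (some sp p<a b<q refl) = ribbon-TLT (addRibbon-added {T} anti corner sp p<a b<q) t

ribboned-NonEmpty : ∀ {T a b U} → NonEmptyRows T → Ribboned T a b U → NonEmptyRows U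
ribboned-NonEmpty ne (none _ refl)     = ne
ribboned-NonEmpty ne (some _ _ _ refl) = addRibbon-NonEmpty ne

-- The cell beside the corner separates the two constructors; when both tableaux received a ribbon,
-- uniqueness of the ribbon gives equal shapes.
ribboned-injective : ∀ {T T′ a b U} → NonEmptyRows T → NonEmptyRows T′ →
  Antitone (rowLen T) → Antitone (rowLen T′) → Corner (at T) a b → Corner (at T′) a b →
  Ribboned T a b U → Ribboned T′ a b U → T ≡ T′
ribboned-injective {T} {T′} ne ne′ anti anti′ corner corner′ (none _ refl) (none _ refl) = refl
ribboned-injective {T} {T′} ne ne′ anti anti′ corner corner′ (none _ refl) (some sp p<a b<q eq) =
  contradiction (ribbon-beside (subst (λ U → RibbonAdded _ U _ _ _ _) eq
      (addRibbon-added {T′} anti′ corner′ sp p<a b<q)))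
    (proj₂ (proj₂ corner))
ribboned-injective {T} {T′} ne ne′ anti anti′ corner corner′ (some sp p<a b<q eq) (none _ refl) =
  contradiction (ribbon-beside (subst (λ U → RibbonAdded _ U _ _ _ _) eq
      (addRibbon-added {T} anti corner sp p<a b<q)))
    (proj₂ (proj₂ corner′))
ribboned-injective {T} {T′} ne ne′ anti anti′ corner corner′ (some sp p<a b<q refl)
    (some sp′ p′<a b<q′ eq) =
  rowLen-ext ne ne′ (ribbon-unique r r′)
    (RibbonAdded.point⇒ r′ ∘ RibbonAdded.point⇐ r) (RibbonAdded.point⇒ r ∘ RibbonAdded.point⇐ r′)
  where
  r  = addRibbon-added {T} anti corner sp p<a b<q
  r′ = subst (λ U → RibbonAdded _ U _ _ _ _) eq (addRibbon-added {T′} anti′ corner′ sp′ p′<a b<q′)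

-- The unique special point of `T` decides the constructor: it is either the corner itself or, by
-- `p < a`, in a higher row.
ribboned-functional : ∀ {T a b U V} → Antitone (rowLen T) → Ribboned T a b U → Ribboned T a b V → U ≡ V
ribboned-functional anti (none _ refl) (none _ refl) = refl
ribboned-functional {T} anti (none s _) (some s′ p<a _ _) =
  contradiction p<a (<-irrefl (proj₁ (special-unique (antitone-down {T} anti) s′ s)))
ribboned-functional {T} anti (some s p<a _ _) (none s′ _) =
  contradiction p<a (<-irrefl (proj₁ (special-unique (antitone-down {T} anti) s s′)))
ribboned-functional {T} anti (some s _ _ refl) (some s′ _ _ refl)
  with refl , refl ← special-unique (antitone-down {T} anti) s s′ = refl

-- Arises when the edge is the bottom edge of the special cell, where Insertpoint adds nothing.
addRibbon-trivial : ∀ {T p q} → NonEmptyRows T → Corner (at T) (suc p) q →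
    addRibbon T (p , q) (suc p) ≡ T
addRibbon-trivial {T} {p} {q} ne corner = rowLen-ext (addRibbon-NonEmpty ne) ne len
    (addRibbon-point⇒ T) (addRibbon-point⇐ T)
  where
  U = addRibbon T (p , q) (suc p)
  sp<len : suc p < length T
  sp<len = rowLen-pos⇒ T (subst (0 <_) (sym (corner-rowLen {T} corner)) (s≤s z≤n))
  len : ∀ i → rowLen U i ≡ rowLen T i
  len i with i ≤? p
  ... | yes i≤p = addRibbon-rowLen-same T p q (suc p) i λ x → ribbonRow-above T q (suc p) x i≤p
  ... | no  i≰p with m≤n⇒m<n∨m≡n (≰⇒> i≰p)
  ... | inj₁ sp<i = addRibbon-rowLen-same T p q (suc p) i λ x → ribbonRow-below T p q x sp<i
  ... | inj₂ refl with x , e ← nth-< T sp<len =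
    trans (addRibbon-rowLen T p q (suc p) (suc p) e)
        (trans (cong length (ribbonRow-last T {p} q x ≤-refl))
      (trans (length-extendTo x (≤-reflexive (trans (sym (rowLen-just T e))
          (corner-rowLen {T} corner))))
        (sym (corner-rowLen {T} corner))))

insertPoint-special : ∀ T e {p q} → special T ≡ just (p , q) → insertPoint T e ≡
  (if indexOf (horiz q) (edges T) <ᵇ indexOf e (edges T) then insertLine T e
   else addRibbon (insertLine T e) (shiftCell T e (p , q)) (proj₁ (newPoint T e)))
insertPoint-special T e eq rewrite eq = refl

inserted-special : ∀ {A A′ ℓ e p q r c} → (∀ {i j} → j < ℓ i → Cell A i j) → Down A → Special A p q →
  LineInserted A A′ e r c → ℓ ⊢ horiz q ≺ e → Special A′ r c
inserted-special cell down sp (row ins)    (hh q<c) = row-special-new ins down sp (<⇒≤ q<c)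
inserted-special cell down sp (column ins) (hv q<)  = column-special-new ins sp (cell q<)

-- A row inserted before the special point goes in below row `p`, so the point keeps its
-- coordinates. A column inserted before it cuts through row `p` at or left of `q` and pushes it to
-- `suc q`. The tests in `shiftCell` come out accordingly.
before-special-ribboned : ∀ {T e p q} → Down (at T) → Special (at T) p q →
  LineInserted (at T) (at (insertLine T e)) e (proj₁ (newPoint T e)) (proj₂ (newPoint T e)) →
  rowLen T ⊢ e ≺ horiz q → Ribboned (insertLine T e) (proj₁ (newPoint T e)) (proj₂ (newPoint T e))
    (addRibbon (insertLine T e) (shiftCell T e (p , q)) (proj₁ (newPoint T e)))
before-special-ribboned {T} {p = p} {q} down sp (row {r} {c} ins) (hh c<q)
  with p<r ← cell⇒<colLen T down (down ≤-refl (<⇒≤ c<q) (point⇒cell (at T) (Special.point sp)))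
  rewrite dec-false (colLen T c ≤? p) (<⇒≱ p<r) = some
      (row-special-old ins down sp c<q p<r) p<r c<q refl
before-special-ribboned {T} {p = p} {q} down sp (column {r} ins) (vh ℓr≤q)
  with ¬cell ← (λ (x : Cell (at T) r q) → <⇒≱ (cell⇒< T x) ℓr≤q)
  with p<r ← ≰⇒> (λ r≤p → ¬cell (down r≤p ≤-refl (point⇒cell (at T) (Special.point sp))))
  rewrite dec-true (p ≤? r) (<⇒≤ p<r) | dec-true (rowLen T r ≤? q) ℓr≤q =
  some (subst (Special (at (insertLine T (vert r))) p) (skip-≥ ℓr≤q)
      (column-special-old ins sp ¬cell)) p<r (s≤s ℓr≤q) refl

-- At equal positions the definition still calls `addRibbon`, but the new point is in row `suc p`
-- and column `q`, so that row already has the length asked for.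
at-special-ribboned : ∀ {T p q} → NonEmptyRows T → Down (at T) → Special (at T) p q →
  ColumnInserted q (colLen T q) (flip (at T)) (flip (at (insertLine T (horiz q)))) →
  Ribboned (insertLine T (horiz q)) (colLen T q) q
    (addRibbon (insertLine T (horiz q)) (shiftCell T (horiz q) (p , q)) (colLen T q))
at-special-ribboned {T} {p} {q} ne down sp ins
  with len ← colLen-bottom {T} down (Special.point sp) (Special.bottom sp)
  rewrite dec-false (colLen T q ≤? p) (<⇒≱ (≤-reflexive (sym len))) =
  none (row-special-new ins down sp ≤-refl) (sym (trans (cong (addRibbon T′ (p , q)) len)
    (addRibbon-trivial (insertLine-NonEmpty (horiz q) ne)
        (subst (λ r → Corner (at T′) r q) len (inserted-Corner (row ins))))))
  where
  T′ = insertLine T (horiz q)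

insertPoint-ribboned : ∀ {n T e} → IsTLT n T → e ∈ edges T →
  Ribboned (insertLine T e) (proj₁ (newPoint T e)) (proj₂ (newPoint T e)) (insertPoint T e)
insertPoint-ribboned {n} {T} {e} isT e∈
  with p , q , eq , sp ← special-spec {n} {T} (toTLT isT)
  rewrite insertPoint-special T e eq
  with inserted ← insertLine-inserted isT e∈
  with q∈ ← horiz-edge {T} {q} (cell⇒< T {0} (TLT.down (toTLT isT) z≤n ≤-refl
      (point⇒cell (at T) (Special.point sp))))
  with sorted ← edges-sorted {T} (down-antitone {T} (TLT.down (toTLT isT)))
  with indexOf (horiz q) (edges T) <? indexOf e (edges T)
... | yes after rewrite dec-true (indexOf (horiz q) (edges T) <? indexOf e (edges T)) after =
  none (inserted-special (<⇒cell T) (TLT.down (toTLT isT)) sp inserted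
      (indexOf-< sorted q∈ e∈ after)) refl
... | no ¬after rewrite dec-false (indexOf (horiz q) (edges T) <? indexOf e (edges T)) ¬after
  with m≤n⇒m<n∨m≡n (≮⇒≥ ¬after)
... | inj₁ before = before-special-ribboned {T} (TLT.down (toTLT isT)) sp inserted
    (indexOf-< sorted e∈ q∈ before)
... | inj₂ same with refl ← indexOf-injective e∈ q∈ same with row ins ← inserted =
  at-special-ribboned {T} (proj₁ (IsTLT.ferrers isT)) (TLT.down (toTLT isT)) sp ins

ribboned-surjective : ∀ {n U} → IsTLT n U → ∃ λ T → ∃₂ λ a b →
    IsTLT n T × Corner (at T) a b × Ribboned T a b U
ribboned-surjective {n} {U} u with a , b , _ , sp ← special-spec {n} {U} (toTLT u) with cell?
    (at U) a (suc b)
... | no ¬beside = U , a , b , u , (Special.point sp , Special.bottom sp , ¬beside) , none sp refl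
... | yes beside with T , p , q , ne , t , corner , spT , p<a , b<q , eq ← remove-ribbon
    (proj₁ (IsTLT.ferrers u)) (toTLT u) sp beside
  = T , a , b , fromTLT ne t , corner , some spT p<a b<q eq

-- Bijectivity

module _ {n T e} (t : IsTLT n T) (e∈ : e ∈ edges T) where

  insertLine-TLT : TLT (suc n) (at (insertLine T e))
  insertLine-TLT = inserted-TLT (insertLine-inserted t e∈) (toTLT t)

  insertLine-antitone : Antitone (rowLen (insertLine T e))
  insertLine-antitone = down-antitone {insertLine T e} (TLT.down insertLine-TLT)

  insertLine-Corner : Corner (at (insertLine T e)) (proj₁ (newPoint T e)) (proj₂ (newPoint T e))
  insertLine-Corner = inserted-Corner (insertLine-inserted t e∈)

  insertLine-nonEmpty : NonEmptyRows (insertLine T e)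
  insertLine-nonEmpty = insertLine-NonEmpty e (proj₁ (IsTLT.ferrers t))

  insertPoint-TLT : IsTLT (suc n) (insertPoint T e)
  insertPoint-TLT = fromTLT (ribboned-NonEmpty insertLine-nonEmpty (insertPoint-ribboned t e∈))
    (ribboned-TLT insertLine-antitone insertLine-Corner insertLine-TLT (insertPoint-ribboned t e∈))

  newPoint-special : Special (at (insertPoint T e)) (proj₁ (newPoint T e)) (proj₂ (newPoint T e))
  newPoint-special = ribboned-special insertLine-antitone insertLine-Corner (insertPoint-ribboned t e∈)

insertPoint-injective : ∀ {n T T′ e e′} → IsTLT n T → IsTLT n T′ → e ∈ edges T → e′ ∈ edges T′ →
  insertPoint T e ≡ insertPoint T′ e′ → T ≡ T′ × e ≡ e′
insertPoint-injective {n} {T} {T′} {e} {e′} t t′ x x′ eq =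
    at-ext (proj₁ (IsTLT.ferrers t)) (proj₁ (IsTLT.ferrers t′)) (proj₂ same) , proj₁ same
  where
  special≡ : proj₁ (newPoint T e) ≡ proj₁ (newPoint T′ e′) × proj₂ (newPoint T e) ≡ proj₂
      (newPoint T′ e′)
  special≡ = special-unique (TLT.down (toTLT (insertPoint-TLT t x))) (newPoint-special t x)
    (subst (λ U → Special (at U) _ _) (sym eq) (newPoint-special t′ x′))
  transport : (P : ℕ → ℕ → Set) → P (proj₁ (newPoint T′ e′)) (proj₂ (newPoint T′ e′)) →
      P (proj₁ (newPoint T e)) (proj₂ (newPoint T e))
  transport P y = subst₂ P (sym (proj₁ special≡)) (sym (proj₂ special≡)) y
  line≡ : insertLine T e ≡ insertLine T′ e′
  line≡ = ribboned-injective (insertLine-nonEmpty t x) (insertLine-nonEmpty t′ x′)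
      (insertLine-antitone t x) (insertLine-antitone t′ x′)
    (insertLine-Corner t x) (transport (Corner (at (insertLine T′ e′))) (insertLine-Corner t′ x′))
    (insertPoint-ribboned t x)
    (transport (λ a b → Ribboned (insertLine T′ e′) a b (insertPoint T e))
      (subst (Ribboned (insertLine T′ e′) _ _) (sym eq) (insertPoint-ribboned t′ x′)))
  same : e ≡ e′ × (∀ i j → at T i j ≡ at T′ i j)
  same = inserted-injective (toTLT t) (toTLT t′) (insertLine-inserted t x)
    (transport (LineInserted (at T′) (at (insertLine T e)) e′)
      (subst (λ U → LineInserted (at T′) (at U) e′ _ _) (sym line≡) (insertLine-inserted t′ x′)))

-- The recovered pair yields the same line-inserted tableau with the same corner, so both its image
-- and `U` are `Ribboned` results of it and coincide.
insertPoint-surjective : ∀ {n U} → 1 ≤ n → IsTLT (suc n) U →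
  ∃ λ T → ∃ λ e → IsTLT n T × e ∈ edges T × insertPoint T e ≡ U
insertPoint-surjective 1≤n u
  with V , a , b , v , corner , ribboned ← ribboned-surjective u
  with T , e , t , x , refl , refl ← insertLine-surjective 1≤n v corner =
  T , e , t , x , ribboned-functional (insertLine-antitone t x) (insertPoint-ribboned t x) ribboned

theorem2p3 : ∀ (n : ℕ) → 1 ≤ n →
    (∀ (T : Raw) (e : Edge) → IsTLT n T → e ∈ edges T →
    IsTLT (suc n) (insertPoint T e))
    × (∀ (T T′ : Raw) (e e′ : Edge) → IsTLT n T → IsTLT n T′ →
    e ∈ edges T → e′ ∈ edges T′ →
    insertPoint T e ≡ insertPoint T′ e′ → T ≡ T′ × e ≡ e′)
    × (∀ (U : Raw) → IsTLT (suc n) U →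
    ∃ λ T → ∃ λ e → IsTLT n T × e ∈ edges T × insertPoint T e ≡ U)
theorem2p3 n 1≤n =
    (λ T e → insertPoint-TLT)
  , (λ T T′ e e′ → insertPoint-injective)
  , (λ U → insertPoint-surjective 1≤n)
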